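{- For each $a\in\{0,1,2\}$, the stable defect set $\mathscr{D}^a_{st}$ is well-ordered, of order type $\omega^\omega$. Furthermore, for every nonnegative integer $k$ with $k\equiv a\pmod 3$, the set $\mathscr{D}^a_{st}\cap[0,k]$ has order type $\omega^k$.
   Context: $\|n\|$ is the complexity of a positive integer $n$: the least number of $1$'s needed to write $n$ using $1$, $+$, $\times$ and parentheses; $\delta(n)=\|n\|-3\log_3 n$ is its defect. A positive integer $m$ is stable if $\|3^km\|=3k+\|m\|$ for all $k\ge1$. $\mathscr{D}_{st}$ is the set of defects $\delta(m)$ of stable numbers $m$. For a congruence class $a$ mod $3$, $\mathscr{D}^a=\{\delta(n):\|n\|\equiv a\pmod 3,\ n\ne1\}$ and $\mathscr{D}^a_{st}=\mathscr{D}^a\cap\mathscr{D}_{st}$. These are subsets of $\mathbb{R}$ with the usual order. -}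

module Defs where

open import Data.Nat using (ℕ; zero; suc; _+_; _*_; _^_; _≤_; _<_; _≥_; _%_)
open import Data.Product using (Σ; ∃; ∃-syntax; _×_; _,_)
open import Data.List using (List)
open import Data.List.Relation.Unary.All using (All)
open import Data.List.Relation.Unary.Linked using (Linked)
open import Data.List.Relation.Binary.Lex.Strict using (Lex-<)
open import Relation.Binary.PropositionalEquality using (_≡_)
open import Relation.Nullary using (¬_)
open import Induction.WellFounded using (WellFounded)
open import Function.Bundles using (_⇔_)

data Expr : Set where
  one  : Expr
  plus : Expr → Expr → Expr
  times : Expr → Expr → Expr

val : Expr → ℕ
val one = 1
val (plus e f) = val e + val f
val (times e f) = val e * val f

ones : Expr → ℕ
ones one = 1
ones (plus e f) = ones e + ones f
ones (times e f) = ones e + ones f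

IsCpx : ℕ → ℕ → Set
IsCpx n c = (∃[ e ] (val e ≡ n × ones e ≡ c)) × (∀ e → val e ≡ n → c ≤ ones e)

-- Comparison of defects δ(n) = ‖n‖ - 3 log₃ n, via exact integer arithmetic:
-- δ(n) < δ(m)  ⇔  3^‖n‖ · m³ < 3^‖m‖ · n³
_δ<_ : ℕ → ℕ → Set
n δ< m = ∃[ cn ] ∃[ cm ] (IsCpx n cn × IsCpx m cm × 3 ^ cn * m ^ 3 < 3 ^ cm * n ^ 3)

_δ≈_ : ℕ → ℕ → Set
n δ≈ m = ∃[ cn ] ∃[ cm ] (IsCpx n cn × IsCpx m cm × 3 ^ cn * m ^ 3 ≡ 3 ^ cm * n ^ 3)

δ≤ : ℕ → ℕ → Set
δ≤ n k = ∃[ c ] (IsCpx n c × 3 ^ c ≤ 3 ^ k * n ^ 3)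

Stable : ℕ → Set
Stable m = 1 ≤ m × (∀ k c → 1 ≤ k → IsCpx m c → IsCpx (3 ^ k * m) (3 * k + c))

-- n witnesses an element δ(n) of 𝒟^a_st = 𝒟^a ∩ 𝒟_st
InDaSt : ℕ → ℕ → Set
InDaSt a n = 1 ≤ n × ¬ (n ≡ 1) × (∃[ c ] (IsCpx n c × c % 3 ≡ a))
             × (∃[ m ] (Stable m × m δ≈ n))

-- Ordinals below ω^ω in Cantor normal form ω^{e₁}+…+ω^{eᵣ}, e₁ ≥ … ≥ eᵣ,
-- represented by the exponent list; the ordinal order is the strict
-- lexicographic order (a proper prefix is smaller).
CNF : List ℕ → Set
CNF = Linked _≥_

_<O_ : List ℕ → List ℕ → Set
_<O_ = Lex-< _≡_ _<_

CNFbelow : ℕ → List ℕ → Set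
CNFbelow k es = CNF es × All (_< k) es

-- The set {δ(n) : P n} (a set of reals, represented by witnesses n modulo δ≈)
-- is order-isomorphic to the ordinal {es : O es}.
record OrderTypeIs (P : ℕ → Set) (O : List ℕ → Set) : Set where
  field
    f      : Σ ℕ P → List ℕ
    f-in   : ∀ x → O (f x)
    f-surj : ∀ es → O es → ∃[ x ] (f x ≡ es)
    f-eq   : ∀ (x y : Σ ℕ P) → (Σ.proj₁ x δ≈ Σ.proj₁ y) ⇔ (f x ≡ f y)
    f-lt   : ∀ (x y : Σ ℕ P) → (Σ.proj₁ x δ< Σ.proj₁ y) ⇔ (f x <O f y)

WellOrderedδ : (P : ℕ → Set) → Set
WellOrderedδ P = WellFounded (λ (x y : Σ ℕ P) → Σ.proj₁ x δ< Σ.proj₁ y)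

{-# OPTIONS --safe #-}
module Submission where

-- Represent the class of n with ‖n‖ = a + 3i by the rational n / 3ⁱ; the defect order becomes >. Let T_c be the
-- set of m / 3ⁱ such that m can be written with c + 3i ones. Then T_{c-1} ⊆ T_c, and the stable defects of class a are
-- the points of T_a outside T_{a-1}. The point is that T_{c-1} is exactly the derived set of T_c: adding 1/3ʲ costs one
-- unit of budget, so points of T_{c-1} are limits, and conversely T_c is discrete elsewhere and closed and well-ordered
-- by >. The converse is an induction on a defect bound: above a positive bound, an element of T_c is one of finitely many
-- rationals, or x + b/3ⁱ with b from a finite list and x ∈ T_{c-j} of smaller defect, or a product of two elements of
-- smaller defect. Thus the Cantor–Bendixson rank of a point of T_a is the largest e with the point in T_{a-e}, and the
-- Cantor normal form of its position is read off from the ranks met when climbing from it. The bound [0,k] with k ≡ a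
-- cuts T_a at the greatest point of T_{a-k}, the first one of rank k.

-- Two difficulties shape the proof. First, suprema, infima and membership must all be computed. A
-- truncation of `T` by a defect bound is not a set that induction can build, because sums and
-- products of truncated sets overshoot the truncation. `Cover` therefore asks for a sandwich: a
-- tame set that contains the truncation, lies in `T c d`, and accumulates only in `T c (suc d)`.
-- Second, the induction needs a fixed amount by which the defect drops. It comes from the ratio
-- m³/3ⁿ for m written with n ones: this is 1 for an optimally written power of 3 and at most 8/9
-- otherwise, 8/9 being the ratio of 2 = 1 + 1. A product of two factors with ratio at most 8/9 thus
-- splits into factors that are each better by 9/8. A factor of ratio 1 brings no progress and is
-- moved into the factor 3ᵏ of `T`. A sum gains the same 9/8 by dropping its smaller summand, once
-- the larger one has enough ones.

open import Data.Empty using (⊥; ⊥-elim)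
open import Data.Product
open import Data.Sum using (_⊎_; inj₁; inj₂; [_,_]′)
open import Relation.Binary.PropositionalEquality hiding ([_])
open import Relation.Nullary using (¬_; Dec; yes; no)

-- Tame sets: positive rationals with computable neighbours

module TameSets where
  open import Data.Rational hiding (positive)
  open import Data.Rational.Properties
  open import Data.List using (List; []; _∷_)
  open import Data.List.Relation.Unary.Any as Any using (Any; here; there)
  open import Function using (_∘_; id)
  open import Induction.WellFounded using (Acc; acc)
  open import Level using (0ℓ)
  open import Relation.Binary.Definitions using (tri<; tri≈; tri>)
  open import Relation.Unary using (Pred; _⊆_; _∪_; ∅)

  ℚSet : Set₁
  ℚSet = Pred ℚ 0ℓ

  private variable
    X X′ Y Y′ Z D : ℚSet
    x y q r : ℚ

  Above : ℚSet → ℚ → ℚ → Set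
  Above X y x = X y × x < y

  NoneBelow NoneAbove : ℚSet → ℚ → Set
  NoneBelow X q = ∀ {x} → X x → q ≤ x
  NoneAbove X q = ∀ {x} → X x → x ≤ q

  record GreatestBelow (X : ℚSet) (q : ℚ) : Set where
    constructor greatest
    field
      point    : ℚ
      member   : X point
      below-q  : point < q
      maximal  : ∀ {x} → X x → x < q → x ≤ point

  record LeastAbove (X : ℚSet) (q : ℚ) : Set where
    constructor least
    field
      point    : ℚ
      member   : X point
      above-q  : q < point
      minimal  : ∀ {x} → X x → q < x → point ≤ x

  Sup : ℚSet → ℚ → Set
  Sup X q = NoneBelow X q ⊎ GreatestBelow X q

  -- `limit` asserts only that q lies in D, not that X accumulates at q: D is an upper bound for the
  -- set of limit points, which is all that survives unions and products.
  data Inf (D X : ℚSet) (q : ℚ) : Set where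
    limit   : D q → Inf D X q
    empty   : NoneAbove X q → Inf D X q
    attains : LeastAbove X q → Inf D X q

  -- As > well-orders X, limits occur only from above; hence the asymmetry between `below` and
  -- `above`. The latter is restricted to q > 0 in view of `T c d`, which accumulates at 0.
  record Tame (X X′ : ℚSet) : Set where
    field
      positive : X x → 0ℚ < x
      upper    : ℚ
      bounded  : X x → x < upper
      derived⊆ : X′ ⊆ X
      below    : ∀ q → Sup X q
      above    : ∀ q → 0ℚ < q → Inf X′ X q
      wf       : ∀ q → Acc (Above X) q

  ≤∧≢⇒< : x ≤ y → x ≢ y → x < y
  ≤∧≢⇒< {x} {y} x≤y x≢y with <-cmp x y
  ... | tri< x<y _ _ = x<y
  ... | tri≈ _ x≡y _ = ⊥-elim (x≢y x≡y)
  ... | tri> _ _ y<x = ⊥-elim (<-irrefl refl (<-≤-trans y<x x≤y))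

  <⇒≱ : x < y → ¬ y ≤ x
  <⇒≱ x<y y≤x = <-irrefl refl (<-≤-trans x<y y≤x)

  sup-cong : X ⊆ Y → (∀ {x} → Y x → x < q → X x) → Sup X q → Sup Y q
  sup-cong X⊆Y Y⊆X (inj₁ none) = inj₁ λ Yx → ≮⇒≥ λ x<q → <⇒≱ x<q (none (Y⊆X Yx x<q))
  sup-cong X⊆Y Y⊆X (inj₂ (greatest p Xp p<q max)) =
    inj₂ (greatest p (X⊆Y Xp) p<q λ Yx x<q → max (Y⊆X Yx x<q) x<q)

  sup-∪ : Sup X q → Sup Y q → Sup (X ∪ Y) q
  sup-∪ (inj₁ nX) (inj₁ nY) = inj₁ [ nX , nY ]′
  sup-∪ (inj₁ nX) (inj₂ (greatest p Yp p<q max)) =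
    inj₂ (greatest p (inj₂ Yp) p<q λ { (inj₁ Xx) x<q → ⊥-elim (<⇒≱ x<q (nX Xx)) ; (inj₂ Yx) x<q → max Yx x<q })
  sup-∪ (inj₂ (greatest p Xp p<q max)) (inj₁ nY) =
    inj₂ (greatest p (inj₁ Xp) p<q λ { (inj₂ Yx) x<q → ⊥-elim (<⇒≱ x<q (nY Yx)) ; (inj₁ Xx) x<q → max Xx x<q })
  sup-∪ (inj₂ (greatest p Xp p<q pmax)) (inj₂ (greatest r Yr r<q rmax)) with ≤-total p r
  ... | inj₁ p≤r = inj₂ (greatest r (inj₂ Yr) r<q
          λ { (inj₁ Xx) x<q → ≤-trans (pmax Xx x<q) p≤r ; (inj₂ Yx) x<q → rmax Yx x<q })
  ... | inj₂ r≤p = inj₂ (greatest p (inj₁ Xp) p<q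
          λ { (inj₁ Xx) x<q → pmax Xx x<q ; (inj₂ Yx) x<q → ≤-trans (rmax Yx x<q) r≤p })

  inf-cong : X ⊆ Y → (∀ {x} → Y x → q < x → X x) → Inf D X q → Inf D Y q
  inf-cong X⊆Y Y⊆X (limit Dq) = limit Dq
  inf-cong X⊆Y Y⊆X (empty none) = empty (λ Yx → ≮⇒≥ λ q<x → <⇒≱ q<x (none (Y⊆X Yx q<x)))
  inf-cong X⊆Y Y⊆X (attains (least p Xp q<p min)) =
    attains (least p (X⊆Y Xp) q<p λ Yx q<x → min (Y⊆X Yx q<x) q<x)

  inf-∪ : Inf D X q → Inf D Y q → Inf D (X ∪ Y) q
  inf-∪ (limit Dq) _ = limit Dq
  inf-∪ _ (limit Dq) = limit Dq
  inf-∪ (empty nX) (empty nY) = empty [ nX , nY ]′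
  inf-∪ (empty nX) (attains (least p Yp q<p min)) =
    attains (least p (inj₂ Yp) q<p λ { (inj₁ Xx) q<x → ⊥-elim (<⇒≱ q<x (nX Xx)) ; (inj₂ Yx) q<x → min Yx q<x })
  inf-∪ (attains (least p Xp q<p min)) (empty nY) =
    attains (least p (inj₁ Xp) q<p λ { (inj₂ Yx) q<x → ⊥-elim (<⇒≱ q<x (nY Yx)) ; (inj₁ Xx) q<x → min Xx q<x })
  inf-∪ (attains (least p Xp q<p pmin)) (attains (least r Yr q<r rmin)) with ≤-total p r
  ... | inj₁ p≤r = attains (least p (inj₁ Xp) q<p
          λ { (inj₁ Xx) q<x → pmin Xx q<x ; (inj₂ Yx) q<x → ≤-trans p≤r (rmin Yx q<x) })
  ... | inj₂ r≤p = attains (least r (inj₂ Yr) q<r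
          λ { (inj₁ Xx) q<x → ≤-trans r≤p (pmin Xx q<x) ; (inj₂ Yx) q<x → rmin Yx q<x })

  inf-weaken : X′ ⊆ Y′ → Inf X′ X q → Inf Y′ X q
  inf-weaken f (limit d) = limit (f d)
  inf-weaken f (empty n) = empty n
  inf-weaken f (attains s) = attains s

  acc-mono : (∀ {x} → Y x → q < x → X x) → q ≤ r → Acc (Above X) q → Acc (Above Y) r
  acc-mono Y⊆X q≤r (acc rs) = acc λ { (Yx , r<x) →
    let q<x = ≤-<-trans q≤r r<x in
    acc-mono (λ Yy x<y → Y⊆X Yy (<-trans q<x x<y)) ≤-refl (rs (Y⊆X Yx q<x , q<x)) }

  -- Each step upwards advances one of the two accessibility proofs; the other bound x or y may lag
  -- behind q, which the inequalities permit.
  acc-∪ : x ≤ q → y ≤ q → Acc (Above X) x → Acc (Above Y) y → Acc (Above (X ∪ Y)) q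
  acc-∪ x≤q y≤q (acc rx) (acc ry) = acc λ
    { (inj₁ Xz , q<z) → acc-∪ ≤-refl (≤-trans y≤q (<⇒≤ q<z)) (rx (Xz , ≤-<-trans x≤q q<z)) (acc ry)
    ; (inj₂ Yz , q<z) → acc-∪ (≤-trans x≤q (<⇒≤ q<z)) ≤-refl (acc rx) (ry (Yz , ≤-<-trans y≤q q<z)) }

  module _ (_∙_ : ℚ → ℚ → ℚ) where

    Image : ℚSet → ℚSet → ℚSet
    Image X Y z = ∃[ x ] ∃[ y ] (X x × Y y × z ≡ x ∙ y)

    module _ (mono : ∀ {x x₀ y y₀} → X x → Y y → X x₀ → Y y₀ → x ≤ x₀ → y ≤ y₀ → (x ∙ y) ≤ (x₀ ∙ y₀)) where
      private
        Corner : ℚ → ℚ → ℚSet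
        Corner a b = Image (λ x → X x × a < x) (λ y → Y y × b < y)

      -- An element above x₀ ∙ y₀ comes from a pair outside the quadrant x ≤ x₀, y ≤ y₀.
      acc-corner : ∀ a b → Acc (Above X) a → Acc (Above Y) b → ∀ q → Acc (Above (Corner a b)) q
      acc-corner a b (acc ra) (acc rb) q = acc λ { ((x₀ , y₀ , (Xx₀ , a<x₀) , (Yy₀ , b<y₀) , refl) , _) →
        acc-mono
          (λ { (x , y , (Xx , a<x) , (Yy , b<y) , refl) z₀<z → outside Xx₀ Yy₀ Xx Yy a<x b<y z₀<z (x ≤? x₀) (y ≤? y₀) })
          ≤-refl
          (acc-∪ ≤-refl ≤-refl (acc-corner x₀ b (ra (Xx₀ , a<x₀)) (acc rb) _)
                               (acc-corner a y₀ (acc ra) (rb (Yy₀ , b<y₀)) _)) }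
        where
        outside : ∀ {x₀ y₀ x y} → X x₀ → Y y₀ → X x → Y y → a < x → b < y → (x₀ ∙ y₀) < (x ∙ y) →
                  Dec (x ≤ x₀) → Dec (y ≤ y₀) → (Corner x₀ b ∪ Corner a y₀) (x ∙ y)
        outside Xx₀ Yy₀ Xx Yy a<x b<y z₀<z (yes x≤x₀) (yes y≤y₀) = ⊥-elim (<⇒≱ z₀<z (mono Xx Yy Xx₀ Yy₀ x≤x₀ y≤y₀))
        outside Xx₀ Yy₀ Xx Yy a<x b<y z₀<z (no x≰x₀) _ = inj₁ (_ , _ , (Xx , ≰⇒> x≰x₀) , (Yy , b<y) , refl)
        outside Xx₀ Yy₀ Xx Yy a<x b<y z₀<z (yes _) (no y≰y₀) = inj₂ (_ , _ , (Xx , a<x) , (Yy , ≰⇒> y≰y₀) , refl)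

      acc-image : (∀ {x} → X x → 0ℚ < x) → (∀ {y} → Y y → 0ℚ < y) →
                  Acc (Above X) 0ℚ → Acc (Above Y) 0ℚ → ∀ q → Acc (Above (Image X Y)) q
      acc-image X>0 Y>0 aX aY q = acc-mono
        (λ { (x , y , Xx , Yy , refl) _ → x , y , (Xx , X>0 Xx) , (Yy , Y>0 Yy) , refl })
        ≤-refl (acc-corner 0ℚ 0ℚ aX aY q)

  module _ (tame : Tame X X′) where
    open Tame tame

    -- q is located by its neighbours: if s is the least point above q, then q is in X exactly if it
    -- is the greatest point below s. With nothing above q, `upper` takes the place of s.
    member? : ∀ q → Dec (X q)
    member? q with 0ℚ <? q
    ... | no q≯0 = no (q≯0 ∘ positive)
    ... | yes q>0 with above q q>0
    ...   | limit X′q = yes (derived⊆ X′q)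
    ...   | empty none = search (below upper)
      where
      search : Sup X upper → Dec (X q)
      search (inj₁ none′) = no λ Xq → <⇒≱ (bounded Xq) (none′ Xq)
      search (inj₂ (greatest p Xp p<u max)) with p ≟ q
      ... | yes refl = yes Xp
      ... | no p≢q = no λ Xq → p≢q (≤-antisym (none Xp) (max Xq (bounded Xq)))
    ...   | attains (least s Xs q<s min) with below s
    ...     | inj₁ none = no λ Xq → <⇒≱ q<s (none Xq)
    ...     | inj₂ (greatest p Xp p<s max) with p ≟ q
    ...       | yes refl = yes Xp
    ...       | no p≢q = no λ Xq → p≢q (≤-antisym (≮⇒≥ λ q<p → <⇒≱ p<s (min Xp q<p)) (max Xq q<s))

    atMost : ∀ q → (∀ {x} → X x → q < x) ⊎ ∃[ p ] (X p × p ≤ q × (∀ {x} → X x → x ≤ q → x ≤ p))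
    atMost q with member? q
    ... | yes Xq = inj₂ (q , Xq , ≤-refl , λ _ → id)
    ... | no ¬Xq with below q
    ...   | inj₁ none = inj₁ λ Xx → ≤∧≢⇒< (none Xx) λ { refl → ¬Xq Xx }
    ...   | inj₂ (greatest p Xp p<q max) =
            inj₂ (p , Xp , <⇒≤ p<q , λ Xx x≤q → max Xx (≤∧≢⇒< x≤q λ { refl → ¬Xq Xx }))

    atLeast : ∀ q → 0ℚ < q → (∀ {x} → X x → x < q) ⊎ ∃[ p ] (X p × q ≤ p × (∀ {x} → X x → q ≤ x → p ≤ x))
    atLeast q q>0 with member? q
    ... | yes Xq = inj₂ (q , Xq , ≤-refl , λ _ → id)
    ... | no ¬Xq with above q q>0
    ...   | limit X′q = ⊥-elim (¬Xq (derived⊆ X′q))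
    ...   | empty none = inj₁ λ Xx → ≤∧≢⇒< (none Xx) λ { refl → ¬Xq Xx }
    ...   | attains (least p Xp q<p min) =
            inj₂ (p , Xp , <⇒≤ q<p , λ Xx q≤x → min Xx (≤∧≢⇒< q≤x λ { refl → ¬Xq Xx }))

  tame-cong : X ⊆ Y → Y ⊆ X → X′ ⊆ Y′ → Y′ ⊆ Y → Tame X X′ → Tame Y Y′
  tame-cong X⊆Y Y⊆X X′⊆Y′ Y′⊆Y t = record
    { positive = positive ∘ Y⊆X ; upper = upper ; bounded = bounded ∘ Y⊆X ; derived⊆ = Y′⊆Y
    ; below = λ q → sup-cong X⊆Y (λ Yx _ → Y⊆X Yx) (below q)
    ; above = λ q q>0 → inf-weaken X′⊆Y′ (inf-cong X⊆Y (λ Yx _ → Y⊆X Yx) (above q q>0))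
    ; wf = λ q → acc-mono (λ Yx _ → Y⊆X Yx) ≤-refl (wf q) }
    where open Tame t

  tame-∅ : Tame ∅ ∅
  tame-∅ = record
    { positive = λ () ; upper = 0ℚ ; bounded = λ () ; derived⊆ = λ ()
    ; below = λ _ → inj₁ λ () ; above = λ _ _ → empty λ () ; wf = λ _ → acc λ () }

  q<q+1 : ∀ q → q < q + 1ℚ
  q<q+1 q = subst (_< q + 1ℚ) (+-identityʳ q) (+-monoʳ-< q (positive⁻¹ 1ℚ))

  -- The decidable side condition A makes a finite list of candidates tame even though only some of
  -- them satisfy the budget equation.
  tame-singleton : ∀ {A : Set} {v} → Dec A → (A → 0ℚ < v) → Tame (λ z → A × z ≡ v) ∅
  tame-singleton (no ¬a) _ = tame-cong (λ ()) (λ { (a , _) → ¬a a }) id (λ ()) tame-∅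
  tame-singleton {v = v} (yes a) v>0 = record
    { positive = λ { (_ , refl) → v>0 a }
    ; upper = v + 1ℚ
    ; bounded = λ { (_ , refl) → q<q+1 v }
    ; derived⊆ = λ ()
    ; below = bel
    ; above = λ q _ → abv q
    ; wf = λ q → acc λ { ((_ , refl) , _) → acc λ { ((_ , refl) , v<v) → ⊥-elim (<-irrefl refl v<v) } } }
    where
    bel : ∀ q → Sup _ q
    bel q with v <? q
    ... | yes v<q = inj₂ (greatest v (a , refl) v<q λ { (_ , refl) _ → ≤-refl })
    ... | no v≮q = inj₁ λ { (_ , refl) → ≮⇒≥ v≮q }
    abv : ∀ q → Inf ∅ _ q
    abv q with q <? v
    ... | yes q<v = attains (least v (a , refl) q<v λ { (_ , refl) _ → ≤-refl })
    ... | no q≮v = empty λ { (_ , refl) → ≮⇒≥ q≮v }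

  tame-∪ : Tame X X′ → Tame Y Y′ → Tame (X ∪ Y) (X′ ∪ Y′)
  tame-∪ s t = record
    { positive = [ S.positive , T.positive ]′
    ; upper = S.upper ⊔ T.upper
    ; bounded = [ (λ Xx → <-≤-trans (S.bounded Xx) (p≤p⊔q S.upper T.upper)) , (λ Yx → <-≤-trans (T.bounded Yx) (p≤q⊔p S.upper T.upper)) ]′
    ; derived⊆ = [ inj₁ ∘ S.derived⊆ , inj₂ ∘ T.derived⊆ ]′
    ; below = λ q → sup-∪ (S.below q) (T.below q)
    ; above = λ q q>0 → inf-∪ (inf-weaken inj₁ (S.above q q>0)) (inf-weaken inj₂ (T.above q q>0))
    ; wf = λ q → acc-∪ ≤-refl ≤-refl (S.wf q) (T.wf q) }
    where
    module S = Tame s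
    module T = Tame t

  ⋃ : ∀ {A : Set} → List A → (A → ℚSet) → ℚSet
  ⋃ as F z = Any (λ a → F a z) as

  tame-⋃ : ∀ {A : Set} {F F′ : A → ℚSet} (as : List A) → (∀ a → Tame (F a) (F′ a)) → Tame (⋃ as F) (⋃ as F′)
  tame-⋃ [] t = tame-cong (λ ()) (λ ()) (λ ()) (λ ()) tame-∅
  tame-⋃ {F = F} {F′} (a ∷ as) t =
    tame-cong (join F) (split F) (join F′) derived (tame-∪ (t a) (tame-⋃ as t))
    where
    join : ∀ F → F a ∪ ⋃ as F ⊆ ⋃ (a ∷ as) F
    join F (inj₁ p) = here p
    join F (inj₂ p) = there p
    split : ∀ F → ⋃ (a ∷ as) F ⊆ F a ∪ ⋃ as F
    split F (here p) = inj₁ p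
    split F (there p) = inj₂ p
    derived : ⋃ (a ∷ as) F′ ⊆ ⋃ (a ∷ as) F
    derived = Any.map λ {b} → Tame.derived⊆ (t b)

-- Products and shrinking translates of tame sets

module TameConstructions where
  open TameSets
  open import Data.Rational hiding (positive)
  import Data.Rational as ℚ
  open import Data.Rational.Properties
  open import Data.Nat as ℕ using (ℕ)
  import Data.Nat.Properties as ℕ
  import Data.Nat.Induction as ℕ
  open import Data.List using (upTo)
  open import Data.List.Membership.Propositional using (lose)
  open import Data.List.Relation.Unary.Any as Any using (Any)
  open import Data.List.Membership.Propositional.Properties using (∈-upTo⁺)
  open import Function using (_∘_; id)
  open import Induction.WellFounded using (Acc; acc)
  open import Relation.Unary using (_⊆_; _∪_; ∅)

  private variable
    X X′ Y Y′ : ℚSet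
    x y q r : ℚ

  *-monoˡ-≤ : 0ℚ < r → x ≤ y → r * x ≤ r * y
  *-monoˡ-≤ {r} r>0 = *-monoˡ-≤-nonNeg r {{pos⇒nonNeg r {{ℚ.positive r>0}}}}

  *-monoʳ-≤ : 0ℚ < r → x ≤ y → x * r ≤ y * r
  *-monoʳ-≤ {r} r>0 = *-monoʳ-≤-nonNeg r {{pos⇒nonNeg r {{ℚ.positive r>0}}}}

  *-mono-≤ : ∀ {x y u v} → 0ℚ < v → 0ℚ < x → x ≤ y → u ≤ v → x * u ≤ y * v
  *-mono-≤ v>0 x>0 x≤y u≤v = ≤-trans (*-monoˡ-≤ x>0 u≤v) (*-monoʳ-≤ v>0 x≤y)

  *-monoˡ-< : 0ℚ < r → x < y → r * x < r * y
  *-monoˡ-< {r} r>0 = *-monoʳ-<-pos r {{ℚ.positive r>0}}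

  *-monoʳ-< : 0ℚ < r → x < y → x * r < y * r
  *-monoʳ-< {r} r>0 = *-monoˡ-<-pos r {{ℚ.positive r>0}}

  *-cancelʳ-≤ : 0ℚ < r → x * r ≤ y * r → x ≤ y
  *-cancelʳ-≤ {r} r>0 = *-cancelʳ-≤-pos r {{ℚ.positive r>0}}

  *-cancelʳ-< : 0ℚ < r → x * r < y * r → x < y
  *-cancelʳ-< {r} r>0 = *-cancelʳ-<-nonNeg r {{pos⇒nonNeg r {{ℚ.positive r>0}}}}

  *-cancelˡ-< : 0ℚ < r → r * x < r * y → x < y
  *-cancelˡ-< {r} r>0 = *-cancelˡ-<-nonNeg r {{pos⇒nonNeg r {{ℚ.positive r>0}}}}

  *-pos : 0ℚ < x → 0ℚ < y → 0ℚ < x * y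
  *-pos {x} {y} x>0 y>0 = subst (_< x * y) (*-zeroʳ x) (*-monoˡ-< x>0 y>0)

  -- Division as an equation, so that matching on `refl` can replace q by w * r.
  quotient : ∀ q → 0ℚ < r → ∃[ w ] (w * r ≡ q)
  quotient {r} q r>0 = q * (1/ r) , (begin
    q * (1/ r) * r   ≡⟨ *-assoc q (1/ r) r ⟩
    q * ((1/ r) * r) ≡⟨ cong (q *_) (*-inverseˡ r) ⟩
    q * 1ℚ           ≡⟨ *-identityʳ q ⟩
    q ∎)
    where
    open ≡-Reasoning
    instance _ = pos⇒nonZero r {{ℚ.positive r>0}}

  quotient-pos : 0ℚ < q → 0ℚ < r → x * r ≡ q → 0ℚ < x
  quotient-pos {q} {r} {x} q>0 r>0 refl = *-cancelʳ-< r>0 (subst (_< x * r) (sym (*-zeroˡ r)) q>0)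

  module _ (s : Tame X X′) (t : Tame Y Y′) where
    private
      module S = Tame s
      module T = Tame t

      P P′ : ℚSet
      P = Image _*_ X Y
      P′ = Image _*_ X′ Y ∪ Image _*_ X Y′

      X≤ : ℚ → ℚSet
      X≤ p x = X x × x ≤ p

      Lower : ℚ → ℚSet
      Lower p = Image _*_ (X≤ p) Y

      lower-mono : ∀ {p p₀} → p ≤ p₀ → Lower p ⊆ Lower p₀
      lower-mono p≤p₀ (x , y , (Xx , x≤p) , Yy , eq) = x , y , (Xx , ≤-trans x≤p p≤p₀) , Yy , eq

    module _ {q} (q>0 : 0ℚ < q) where
      -- The corner (x₀ , y₁) is the least element of Y above q / p, paired with the least element of X above q / y₁;
      -- factorisations not dominating the corner have their X-factor at most q / y₁.
      descend-inf : ∀ y → Acc (Above Y) y → ∀ {p} → X p → y * p ≤ q → Inf P′ (Lower p) q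
      descend-inf y (acc rs) {p} Xp yp≤q with quotient q (S.positive Xp)
      ... | r , refl with T.above r (quotient-pos {x = r} q>0 (S.positive Xp) refl)
      ...   | limit Y′r = limit (inj₂ (p , r , Xp , Y′r , *-comm r p))
      ...   | empty none = empty λ { (x , u , (Xx , x≤p) , Yu , refl) →
                ≤-trans (*-mono-≤ (quotient-pos {x = r} q>0 (S.positive Xp) refl) (S.positive Xx) x≤p (none Yu))
                        (≤-reflexive (*-comm p r)) }
      ...   | attains (least y₁ Yy₁ r<y₁ ymin) = corner
        where
        y<y₁ : y < y₁
        y<y₁ = ≤-<-trans (*-cancelʳ-≤ (S.positive Xp) yp≤q) r<y₁
        y₁>0 = T.positive Yy₁
        w = proj₁ (quotient (r * p) y₁>0)
        w*y₁ : w * y₁ ≡ r * p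
        w*y₁ = proj₂ (quotient (r * p) y₁>0)
        w<p : w < p
        w<p = *-cancelʳ-< y₁>0 (subst (_< p * y₁) (sym w*y₁)
                (subst (r * p <_) (*-comm y₁ p) (*-monoʳ-< (S.positive Xp) r<y₁)))
        r<u : ∀ {x u} → x ≤ p → Y u → r * p < x * u → r < u
        r<u {x} {u} x≤p Yu rp<xu = *-cancelʳ-< (S.positive Xp)
          (<-≤-trans rp<xu (≤-trans (*-monoʳ-≤ (T.positive Yu) x≤p) (≤-reflexive (*-comm p u))))
        Upper : ℚSet
        Upper = Image _*_ (λ x → X x × w < x × x ≤ p) (λ u → Y u × y₁ ≤ u)
        upper-inf : Inf P′ Upper (r * p)
        upper-inf with S.above w (quotient-pos {x = w} q>0 y₁>0 w*y₁)
        ... | limit X′w = limit (inj₁ (w , y₁ , X′w , Yy₁ , sym w*y₁))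
        ... | empty none = ⊥-elim (<⇒≱ w<p (none Xp))
        ... | attains (least x₀ Xx₀ w<x₀ xmin) = attains (least (x₀ * y₁)
                (x₀ , y₁ , (Xx₀ , w<x₀ , xmin Xp w<p) , (Yy₁ , ≤-refl) , refl)
                (subst (_< x₀ * y₁) w*y₁ (*-monoʳ-< y₁>0 w<x₀))
                λ { (x , u , (Xx , w<x , _) , (Yu , y₁≤u) , refl) _ →
                    *-mono-≤ (T.positive Yu) (S.positive Xx₀) (xmin Xx w<x) y₁≤u })
        upper⊆lower : Upper ⊆ Lower p
        upper⊆lower (x , u , (Xx , _ , x≤p) , (Yu , _) , eq) = x , u , (Xx , x≤p) , Yu , eq
        split : ∀ {p₁ z} → (∀ {x} → X x → x ≤ w → x ≤ p₁) → Lower p z → r * p < z → (Upper ∪ Lower p₁) z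
        split pmax (x , u , (Xx , x≤p) , Yu , refl) q<xu with x ≤? w
        ... | yes x≤w = inj₂ (x , u , (Xx , pmax Xx x≤w) , Yu , refl)
        ... | no x≰w = inj₁ (x , u , (Xx , ≰⇒> x≰w , x≤p) , (Yu , ymin Yu (r<u x≤p Yu q<xu)) , refl)
        corner : Inf P′ (Lower p) (r * p)
        corner with atMost s w
        ... | inj₁ none = inf-cong upper⊆lower
                -- With no element of X up to w, `Lower 0ℚ` stands in for the second piece and is
                -- empty by positivity.
                (λ z q<z → [ id , (λ { (x , _ , (Xx , x≤0) , _) → ⊥-elim (<⇒≱ (S.positive Xx) x≤0) }) ]′
                  (split {0ℚ} (λ Xx x≤w → ⊥-elim (<⇒≱ (none Xx) x≤w)) z q<z))
                upper-inf
        ... | inj₂ (p₁ , Xp₁ , p₁≤w , pmax) = inf-cong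
                [ upper⊆lower , lower-mono (≤-trans p₁≤w (<⇒≤ w<p)) ]′ (split pmax)
                (inf-∪ upper-inf (descend-inf y₁ (rs (Yy₁ , y<y₁)) Xp₁
                  (subst (_ ≤_) w*y₁ (subst (_≤ w * y₁) (*-comm p₁ y₁) (*-monoʳ-≤ y₁>0 p₁≤w)))))

      -- `Inner` collects the products whose Y-factor is below r = q / p. In any other product below
      -- q the Y-factor is at least y₁, the least element of Y from r on, so the X-factor is below w
      -- = q / y₁. The threshold in X drops to p₁ while the one in Y rises to y₁, and > is
      -- well-founded on Y.
      descend-sup : ∀ y → Acc (Above Y) y → ∀ {p} → X p → y * p < q → Sup (Lower p) q
      descend-sup y (acc rs) {p} Xp yp<q with quotient q (S.positive Xp)
      ... | r , refl = corner
        where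
        p>0 = S.positive Xp
        r>0 : 0ℚ < r
        r>0 = quotient-pos {x = r} q>0 p>0 refl
        Inner : ℚSet
        Inner = Image _*_ (X≤ p) (λ u → Y u × u < r)
        inner⊆lower : Inner ⊆ Lower p
        inner⊆lower (x , u , Xx , (Yu , _) , eq) = x , u , Xx , Yu , eq
        inner-sup : Sup Inner (r * p)
        inner-sup with T.below r
        ... | inj₁ none = inj₁ λ { (x , u , _ , (Yu , u<r) , refl) → ⊥-elim (<⇒≱ u<r (none Yu)) }
        ... | inj₂ (greatest u₀ Yu₀ u₀<r umax) = inj₂ (greatest (p * u₀)
                (p , u₀ , (Xp , ≤-refl) , (Yu₀ , u₀<r) , refl)
                (subst (p * u₀ <_) (*-comm p r) (*-monoˡ-< p>0 u₀<r))
                λ { (x , u , (Xx , x≤p) , (Yu , u<r) , refl) _ →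
                    *-mono-≤ (T.positive Yu₀) (S.positive Xx) x≤p (umax Yu u<r) })
        only-inner : (∀ {x u} → X x → Y u → r ≤ u → ¬ (x * u < r * p)) → Sup (Lower p) (r * p)
        only-inner no-outer = sup-cong inner⊆lower inner inner-sup
          where
          inner : ∀ {z} → Lower p z → z < r * p → Inner z
          inner (x , u , Xx , Yu , refl) z<q with u <? r
          ... | yes u<r = x , u , Xx , (Yu , u<r) , refl
          ... | no u≮r = ⊥-elim (no-outer (proj₁ Xx) Yu (≮⇒≥ u≮r) z<q)
        corner : Sup (Lower p) (r * p)
        corner with atLeast t r r>0
        ... | inj₁ none = only-inner λ _ Yu r≤u _ → <⇒≱ (none Yu) r≤u
        ... | inj₂ (y₁ , Yy₁ , r≤y₁ , ymin) with quotient (r * p) (T.positive Yy₁)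
        ...   | w , w*y₁ with S.below w
        ...     | inj₁ none = only-inner λ {x} {u} Xx Yu r≤u xu<q → <⇒≱ xu<q (subst (_≤ x * u) w*y₁
                    (≤-trans (*-monoʳ-≤ (T.positive Yy₁) (none Xx)) (*-monoˡ-≤ (S.positive Xx) (ymin Yu r≤u))))
        ...     | inj₂ (greatest p₁ Xp₁ p₁<w pmax) = sup-cong [ inner⊆lower , lower-mono p₁≤p ]′ split
                    (sup-∪ inner-sup (descend-sup y₁ (rs (Yy₁ , y<y₁)) Xp₁ y₁p₁<q))
          where
          y₁>0 = T.positive Yy₁
          y<y₁ : y < y₁
          y<y₁ = <-≤-trans (*-cancelʳ-< p>0 yp<q) r≤y₁
          p₁≤p : p₁ ≤ p
          p₁≤p = ≤-trans (<⇒≤ p₁<w) (*-cancelʳ-≤ y₁>0 (subst (_≤ p * y₁) (sym w*y₁)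
                   (subst (r * p ≤_) (*-comm y₁ p) (*-monoʳ-≤ p>0 r≤y₁))))
          y₁p₁<q : y₁ * p₁ < r * p
          y₁p₁<q = subst (_ <_) w*y₁ (subst (_< w * y₁) (*-comm p₁ y₁) (*-monoʳ-< y₁>0 p₁<w))
          split : ∀ {z} → Lower p z → z < r * p → (Inner ∪ Lower p₁) z
          split (x , u , (Xx , x≤p) , Yu , refl) xu<q with u <? r
          ... | yes u<r = inj₁ (x , u , (Xx , x≤p) , (Yu , u<r) , refl)
          ... | no u≮r = inj₂ (x , u , (Xx , pmax Xx (*-cancelʳ-< y₁>0
                  (≤-<-trans (*-monoˡ-≤ (S.positive Xx) (ymin Yu (≮⇒≥ u≮r)))
                             (subst (x * u <_) (sym w*y₁) xu<q)))) , Yu , refl)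

    private
      all-below-top : ∀ {p} → (∀ {x} → X x → x < S.upper → x ≤ p) → P ⊆ Lower p
      all-below-top pmax (x , y , Xx , Yy , eq) = x , y , (Xx , pmax Xx (S.bounded Xx)) , Yy , eq

      lower⊆P : ∀ {p} → Lower p ⊆ P
      lower⊆P (x , y , (Xx , _) , Yy , eq) = x , y , Xx , Yy , eq

      product>0 : ∀ {z} → P z → 0ℚ < z
      product>0 (x , y , Xx , Yy , refl) = *-pos (S.positive Xx) (T.positive Yy)

      product-below : ∀ q → Sup P q
      product-below q with 0ℚ <? q | S.below S.upper
      ... | no q≯0 | _ = inj₁ λ z → ≤-trans (≮⇒≥ q≯0) (<⇒≤ (product>0 z))
      ... | yes _ | inj₁ none = inj₁ λ { (x , y , Xx , _) → ⊥-elim (<⇒≱ (S.bounded Xx) (none Xx)) }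
      -- The descent starts at p = max X, for which `Lower p` is all of P, with 0 as lower bound in
      -- Y.
      ... | yes q>0 | inj₂ (greatest p Xp _ pmax) = sup-cong lower⊆P (λ z _ → all-below-top pmax z)
              (descend-sup q>0 0ℚ (T.wf 0ℚ) Xp (subst (_< q) (sym (*-zeroˡ p)) q>0))

      product-above : ∀ q → 0ℚ < q → Inf P′ P q
      product-above q q>0 with S.below S.upper
      ... | inj₁ none = empty λ { (x , y , Xx , _) → ⊥-elim (<⇒≱ (S.bounded Xx) (none Xx)) }
      ... | inj₂ (greatest p Xp _ pmax) = inf-cong lower⊆P (λ z _ → all-below-top pmax z)
              (descend-inf q>0 0ℚ (T.wf 0ℚ) Xp (subst (_≤ q) (sym (*-zeroˡ p)) (<⇒≤ q>0)))

    tame-* : Tame P P′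
    tame-* = record
      { positive = product>0
      ; upper = S.upper * T.upper
      ; bounded = λ { (x , y , Xx , Yy , refl) →
          ≤-<-trans (*-monoʳ-≤ (T.positive Yy) (<⇒≤ (S.bounded Xx)))
                    (*-monoˡ-< (<-trans (S.positive Xx) (S.bounded Xx)) (T.bounded Yy)) }
      ; derived⊆ = λ { (inj₁ (x , y , Xx , Yy , eq)) → x , y , S.derived⊆ Xx , Yy , eq
                     ; (inj₂ (x , y , Xx , Yy , eq)) → x , y , Xx , T.derived⊆ Yy , eq }
      ; below = product-below
      ; above = product-above
      ; wf = acc-image _*_ (λ Xx _ _ Yy₀ → *-mono-≤ (T.positive Yy₀) (S.positive Xx))
               S.positive T.positive (S.wf 0ℚ) (T.wf 0ℚ) }

  -- An increasing exhaustion of X by finite stages, where stage i is translated by g i ↓ 0: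
  -- the union of the translates accumulates only at X.
  module _ (s : Tame X X′)
           (W : ℕ → ℚSet) (W⊆X : ∀ {i} → W i ⊆ X)
           (W-mono : ∀ {i j} → i ℕ.≤ j → W i ⊆ W j) (W-exhausts : ∀ {x} → X x → ∃[ i ] W i x)
           (g : ℕ → ℚ) (g>0 : ∀ i → 0ℚ < g i) (g-anti : ∀ {i j} → i ℕ.≤ j → g j ≤ g i)
           (g-small : ∀ {x y} → x < y → ∃[ i ] (∀ j → i ℕ.≤ j → x + g j < y))
           (stage : ∀ i → Tame (λ z → ∃[ x ] (W i x × z ≡ x + g i)) ∅) where
    private
      module S = Tame s

      Stage V V₊ : ℕ → ℚSet
      Stage i z = ∃[ x ] (W i x × z ≡ x + g i)
      V n = ⋃ (upTo n) Stage
      V₊ n z = ∃[ i ] (n ℕ.≤ i × Stage i z)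

    Translates : ℚSet
    Translates z = ∃[ i ] Stage i z

    private
      V-tame : ∀ n → Tame (V n) (⋃ (upTo n) λ _ → ∅)
      V-tame n = tame-⋃ (upTo n) stage

      V⊆Translates : ∀ n → V n ⊆ Translates
      V⊆Translates n v = Any.satisfied v

      split : ∀ n → Translates ⊆ V n ∪ V₊ n
      split n (i , v) with i ℕ.<? n
      ... | yes i<n = inj₁ (lose (∈-upTo⁺ i<n) v)
      ... | no i≮n = inj₂ (i , ℕ.≮⇒≥ i≮n , v)

      x<x+g : ∀ x i → x < x + g i
      x<x+g x i = subst (_< x + g i) (+-identityʳ x) (+-monoʳ-< x (g>0 i))

      join : ∀ n → V n ∪ (X ∪ V₊ n) ⊆ X ∪ Translates
      join n (inj₁ v) = inj₂ (V⊆Translates n v)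
      join n (inj₂ (inj₁ Xx)) = inj₁ Xx
      join n (inj₂ (inj₂ (i , _ , v))) = inj₂ (i , v)

      unjoin : ∀ n → X ∪ Translates ⊆ V n ∪ (X ∪ V₊ n)
      unjoin n (inj₁ Xx) = inj₂ (inj₁ Xx)
      unjoin n (inj₂ v) = [ inj₁ , inj₂ ∘ inj₂ ]′ (split n v)

      below : ∀ q → Sup (X ∪ Translates) q
      below q with S.below q
      ... | inj₁ none = inj₁ λ { (inj₁ Xx) → none Xx
              ; (inj₂ (i , x , Wx , refl)) → ≤-trans (none (W⊆X Wx)) (<⇒≤ (x<x+g x i)) }
      ... | inj₂ (greatest p Xp p<q pmax) with W-exhausts Xp | g-small p<q
      -- From stage n on, p belongs to W n and p + g n is still below q, so p + g n is the greatest
      -- point below q outside the finitely many earlier stages.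
      ...   | k , Wp | l , small = sup-cong (join n) (λ z _ → unjoin n z)
                (sup-∪ (Tame.below (V-tame n) q) (inj₂ (greatest (p + g n)
                  (inj₂ (n , ℕ.≤-refl , p , W-mono (ℕ.m≤m⊔n k l) Wp , refl)) (small n (ℕ.m≤n⊔m k l))
                  λ { (inj₁ Xx) x<q → ≤-trans (pmax Xx x<q) (<⇒≤ (x<x+g p n))
                    ; (inj₂ (i , n≤i , x , Wx , refl)) z<q →
                        +-mono-≤ (pmax (W⊆X Wx) (<-trans (x<x+g x i) z<q)) (g-anti n≤i) })))
        where n = k ℕ.⊔ l

      -- The greatest p ∈ X below q leaves a gap, into which g i fits for late i; so late translates
      -- of points below q stay below q. Only early stages and X itself can then come close to q
      -- from above.
      threshold : ∀ q → ¬ X q → ∃[ n ] (∀ {i x} → n ℕ.≤ i → X x → q < x + g i → q < x)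
      threshold q ¬Xq with S.below q
      ... | inj₁ none = 0 , λ _ Xx _ → ≤∧≢⇒< (none Xx) λ { refl → ¬Xq Xx }
      ... | inj₂ (greatest p Xp p<q pmax) with g-small p<q
      ...   | n , small = n , λ {i} n≤i Xx q<z → ≤∧≢⇒<
                (≮⇒≥ λ x<q → <⇒≱ (<-trans q<z (≤-<-trans (+-monoˡ-≤ (g i) (pmax Xx x<q)) (small i n≤i))) ≤-refl)
                λ { refl → ¬Xq Xx }

      above : ∀ q → 0ℚ < q → Inf X (X ∪ Translates) q
      above q q>0 with member? s q
      ... | yes Xq = limit Xq
      ... | no ¬Xq with threshold q ¬Xq
      ...   | n , beyond = inf-cong (join n) (λ z _ → unjoin n z)
                (inf-∪ (inf-weaken V-derived (Tame.above (V-tame n) q q>0)) (far (S.above q q>0)))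
        where
        V-derived : ⋃ (upTo n) (λ _ → ∅) ⊆ X
        V-derived d = ⊥-elim (proj₂ (Any.satisfied d))
        far : Inf X′ X q → Inf X (X ∪ V₊ n) q
        far (limit X′q) = limit (S.derived⊆ X′q)
        far (empty none) = empty λ { (inj₁ Xx) → none Xx
          ; (inj₂ (i , n≤i , x , Wx , refl)) →
              ≮⇒≥ λ q<z → <⇒≱ (beyond n≤i (W⊆X Wx) q<z) (none (W⊆X Wx)) }
        far (attains (least m Xm q<m mmin)) = attains (least m (inj₁ Xm) q<m
          λ { (inj₁ Xx) q<x → mmin Xx q<x
            ; (inj₂ (i , n≤i , x , Wx , refl)) q<z →
                ≤-trans (mmin (W⊆X Wx) (beyond n≤i (W⊆X Wx) q<z)) (<⇒≤ (x<x+g x i)) })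

      Steps : ℚSet
      Steps z = ∃[ i ] z ≡ g i

      wf-steps : ∀ q → Acc (Above Steps) q
      wf-steps q = acc λ { ((i , refl) , _) → from i (ℕ.<-wellFounded i) }
        where
        from : ∀ i → Acc ℕ._<_ i → Acc (Above Steps) (g i)
        from i (acc rs) = acc λ { ((j , refl) , gi<gj) →
          from j (rs (ℕ.≰⇒> λ i≤j → <⇒≱ gi<gj (g-anti i≤j))) }

    tame-translates : Tame (X ∪ Translates) X
    tame-translates = record
      { positive = λ { (inj₁ Xx) → S.positive Xx
                     ; (inj₂ (i , x , Wx , refl)) → <-trans (S.positive (W⊆X Wx)) (x<x+g x i) }
      ; upper = S.upper + g 0
      ; bounded = λ { (inj₁ Xx) → <-trans (S.bounded Xx) (x<x+g S.upper 0)
                    ; (inj₂ (i , x , Wx , refl)) → +-mono-<-≤ (S.bounded (W⊆X Wx)) (g-anti ℕ.z≤n) }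
      ; derived⊆ = inj₁
      ; below = below
      ; above = above
      ; wf = λ q → acc-∪ ≤-refl ≤-refl (S.wf q)
          -- Forgetting that x lies in W i gives the full sum of X and the steps, where monotonicity
          -- of + yields well-foundedness.
          (acc-mono (λ { (i , x , Wx , eq) _ → x , g i , W⊆X Wx , (i , refl) , eq }) ≤-refl
            (acc-image _+_ (λ _ _ _ _ → +-mono-≤) S.positive (λ { (i , refl) → g>0 i })
              (S.wf 0ℚ) (wf-steps 0ℚ) q)) }

-- The gap at 8/9 and bounds on sums and products

module Complexity where
  open import Defs
  open import Data.Nat
  open import Data.Nat.Properties
  open import Data.Nat.Tactic.RingSolver using (solve-∀)
  open import Data.List using (List; []; _∷_; _++_; cartesianProductWith)
  open import Data.List.Membership.Propositional using (_∈_)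
  open import Data.List.Membership.Propositional.Properties using (∈-++⁺ˡ; ∈-++⁺ʳ; ∈-cartesianProductWith⁺)
  open import Data.List.Relation.Unary.Any using (here; there)
  open import Relation.Nullary.Decidable using (from-yes)

  val>0 : ∀ e → 0 < val e
  val>0 one = s≤s z≤n
  val>0 (plus e f) = ≤-trans (val>0 e) (m≤m+n _ _)
  val>0 (times e f) = *-mono-≤ (val>0 e) (val>0 f)

  ones>0 : ∀ e → 0 < ones e
  ones>0 one = s≤s z≤n
  ones>0 (plus e f) = ≤-trans (ones>0 e) (m≤m+n _ _)
  ones>0 (times e f) = ≤-trans (ones>0 e) (m≤m+n _ _)

  -- Enumeration by depth: the depth never exceeds the number of ones, so every expression with at
  -- most n ones is listed, among others.
  exprs : ℕ → List Expr
  exprs zero = []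
  exprs (suc n) = one ∷ cartesianProductWith plus (exprs n) (exprs n) ++ cartesianProductWith times (exprs n) (exprs n)

  private
    m+n≤1+k⇒m≤k : ∀ {m n k} → 0 < n → m + n ≤ suc k → m ≤ k
    m+n≤1+k⇒m≤k {m} {suc n} {k} _ h = ≤-trans (m≤m+n m n) (≤-pred (subst (_≤ suc k) (+-suc m n) h))

    n+m≤1+k⇒m≤k : ∀ {m n k} → 0 < n → n + m ≤ suc k → m ≤ k
    n+m≤1+k⇒m≤k {m} {n} {k} n>0 h = m+n≤1+k⇒m≤k n>0 (subst (_≤ suc k) (+-comm n m) h)

  ∈-exprs : ∀ {n} e → ones e ≤ n → e ∈ exprs n
  ∈-exprs {zero} e h = ⊥-elim (<⇒≱ (ones>0 e) h)
  ∈-exprs {suc n} one h = here refl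
  ∈-exprs {suc n} (plus e f) h = there (∈-++⁺ˡ (∈-cartesianProductWith⁺ plus
    (∈-exprs e (m+n≤1+k⇒m≤k (ones>0 f) h)) (∈-exprs f (n+m≤1+k⇒m≤k (ones>0 e) h))))
  ∈-exprs {suc n} (times e f) h = there (∈-++⁺ʳ _ (∈-cartesianProductWith⁺ times
    (∈-exprs e (m+n≤1+k⇒m≤k (ones>0 f) h)) (∈-exprs f (n+m≤1+k⇒m≤k (ones>0 e) h))))

  -- The ratio m³/3ⁿ is 1 in the case `pure` and at most 8/9 in the case `slack`; m = n = 2 attains
  -- 8/9.
  data Gap (m n : ℕ) : Set where
    pure  : ∀ k → m ≡ 3 ^ k → n ≡ 3 * k → Gap m n
    slack : 9 * m ^ 3 ≤ 8 * 3 ^ n → Gap m n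

  cube-* : ∀ a b → (a * b) ^ 3 ≡ a ^ 3 * b ^ 3
  cube-* = expanded
    where
    expanded : ∀ a b → a * b * (a * b * (a * b * 1)) ≡ a * (a * (a * 1)) * (b * (b * (b * 1)))
    expanded = solve-∀

  cube-pow : ∀ k → (3 ^ k) ^ 3 ≡ 3 ^ (3 * k)
  cube-pow k = trans (^-*-assoc 3 k 3) (cong (3 ^_) (*-comm k 3))

  gap⇒cube≤ : ∀ {m n} → Gap m n → m ^ 3 ≤ 3 ^ n
  gap⇒cube≤ (pure k refl refl) = ≤-reflexive (cube-pow k)
  gap⇒cube≤ {m} {n} (slack h) = *-cancelˡ-≤ 9 (≤-trans h (*-monoˡ-≤ (3 ^ n) (from-yes (8 ≤? 9))))

  slack-times : ∀ {a b i j} → 9 * a ^ 3 ≤ 8 * 3 ^ i → Gap b j → Gap (a * b) (i + j)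
  slack-times {a} {b} {i} {j} h gb = slack (begin
    9 * (a * b) ^ 3      ≡⟨ cong (9 *_) (cube-* a b) ⟩
    9 * (a ^ 3 * b ^ 3)  ≡⟨ *-assoc 9 (a ^ 3) (b ^ 3) ⟨
    9 * a ^ 3 * b ^ 3    ≤⟨ *-mono-≤ h (gap⇒cube≤ gb) ⟩
    8 * 3 ^ i * 3 ^ j    ≡⟨ *-assoc 8 (3 ^ i) (3 ^ j) ⟩
    8 * (3 ^ i * 3 ^ j)  ≡⟨ cong (8 *_) (^-distribˡ-+-* 3 i j) ⟨
    8 * 3 ^ (i + j)      ∎)
    where open ≤-Reasoning

  gap-times : ∀ {a b i j} → Gap a i → Gap b j → Gap (a * b) (i + j)
  gap-times (pure k refl refl) (pure l refl refl) =
    pure (k + l) (sym (^-distribˡ-+-* 3 k l)) (sym (*-distribˡ-+ 3 k l))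
  gap-times {a} (slack h) gb = slack-times {a} h gb
  gap-times {a} {b} {i} {j} ga@(pure _ _ _) (slack h) =
    subst₂ Gap (*-comm b a) (+-comm j i) (slack-times {b} h ga)

  private
    cube≤⇒1< : ∀ {i} → 8 ≤ 3 ^ i → 2 ≤ i
    cube≤⇒1< {zero} (s≤s ())
    cube≤⇒1< {suc zero} (s≤s (s≤s (s≤s ())))
    cube≤⇒1< {suc (suc i)} _ = s≤s (s≤s z≤n)

    cube≤⇒2< : ∀ {i} → 27 ≤ 3 ^ i → 3 ≤ i
    cube≤⇒2< {i} h with 3 ≤? i
    ... | yes p = p
    ... | no p = ⊥-elim (<⇒≱ (from-yes (9 <? 27)) (≤-trans h (^-monoʳ-≤ 3 {i} {2} (≤-pred (≰⇒> p)))))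

    slack-from : ∀ {m n} k → 9 * m ^ 3 ≤ 8 * 3 ^ k → k ≤ n → Gap m n
    slack-from k h k≤n = slack (≤-trans h (*-monoʳ-≤ 8 (^-monoʳ-≤ 3 k≤n)))

    1+-cube : ∀ t → 9 * (1 + (4 + t)) ^ 3 ≤ 8 * (3 * (4 + t) ^ 3)
    1+-cube t = subst (9 * (5 + t) ^ 3 ≤_) (r t) (m≤m+n (9 * (5 + t) ^ 3) _)
      where
      r : ∀ t → 9 * ((5 + t) * ((5 + t) * ((5 + t) * 1))) + (15 * (t * t * t) + 153 * (t * t) + 477 * t + 411)
              ≡ 8 * (3 * ((4 + t) * ((4 + t) * ((4 + t) * 1))))
      r = solve-∀

    -- Among these sums only 3 = 1 + 2 with three ones is pure. For b ≥ 4, adding 1 multiplies the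
    -- cube by at most 125/64 < 8/3, while the additional ones contribute at least a factor 3.
    gap-suc : ∀ {b i j} → 0 < b → Gap b j → 0 < i → 0 < j → Gap (1 + b) (i + j)
    gap-suc {1} _ gb i>0 j>0 = slack-from 2 (from-yes (72 ≤? 72)) (+-mono-≤ i>0 j>0)
    gap-suc {2} {i} {j} _ gb i>0 j>0 with m≤n⇒m<n∨m≡n (+-mono-≤ i>0 (cube≤⇒1< (gap⇒cube≤ gb)))
    ... | inj₂ eq = pure 1 refl (sym eq)
    ... | inj₁ 4≤n = slack-from 4 (from-yes (243 ≤? 648)) 4≤n
    gap-suc {3} _ gb i>0 j>0 = slack-from 4 (from-yes (576 ≤? 648)) (+-mono-≤ i>0 (cube≤⇒2< (gap⇒cube≤ gb)))
    gap-suc {suc (suc (suc (suc b)))} {i} {j} _ gb i>0 j>0 = slack (begin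
      9 * (1 + (4 + b)) ^ 3  ≤⟨ 1+-cube b ⟩
      8 * (3 * (4 + b) ^ 3)  ≤⟨ *-monoʳ-≤ 8 (*-mono-≤ {3} {3 ^ i} (^-monoʳ-≤ 3 {1} {i} i>0) (gap⇒cube≤ gb)) ⟩
      8 * (3 ^ i * 3 ^ j)    ≡⟨ cong (8 *_) (^-distribˡ-+-* 3 i j) ⟨
      8 * 3 ^ (i + j)        ∎)
      where open ≤-Reasoning

    -- For B ≥ 2 the sum 2 + B is at most the product 2B, and the factor 2 brings the ratio 8/9.
    gap-2+ : ∀ {b i j} → Gap 2 i → Gap (2 + b) j → Gap (2 + (2 + b)) (i + j)
    gap-2+ {b} {i} {j} ga gb = slack (begin
      9 * (2 + (2 + b)) ^ 3  ≤⟨ *-monoʳ-≤ 9 (^-monoˡ-≤ 3 (subst (2 + (2 + b) ≤_) (e b) (m≤m+n (4 + b) b))) ⟩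
      9 * (2 * (2 + b)) ^ 3  ≡⟨ cong (9 *_) (cube-* 2 (2 + b)) ⟩
      9 * (8 * (2 + b) ^ 3)  ≡⟨ f ((2 + b) ^ 3) ⟩
      8 * (9 * (2 + b) ^ 3)  ≤⟨ *-monoʳ-≤ 8 (*-mono-≤ (^-monoʳ-≤ 3 {2} {i} (cube≤⇒1< (gap⇒cube≤ ga))) (gap⇒cube≤ gb)) ⟩
      8 * (3 ^ i * 3 ^ j)    ≡⟨ cong (8 *_) (^-distribˡ-+-* 3 i j) ⟨
      8 * 3 ^ (i + j)        ∎)
      where
      open ≤-Reasoning
      e : ∀ b → 4 + b + b ≡ 2 * (2 + b)
      e = solve-∀
      f : ∀ x → 9 * (8 * x) ≡ 8 * (9 * x)
      f = solve-∀

    -- For A, B ≥ 3 one has 1/A + 1/B ≤ 2/3, so A + B is at most 2/3 of the product; (2/3)³ = 8/27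
    -- is below 8/9.
    gap-3+ : ∀ {a b i j} → Gap (3 + a) i → Gap (3 + b) j → Gap ((3 + a) + (3 + b)) (i + j)
    gap-3+ {a} {b} {i} {j} ga gb = slack (begin
      9 * (A + B) ^ 3        ≤⟨ *-monoˡ-≤ ((A + B) ^ 3) (from-yes (9 ≤? 27)) ⟩
      27 * (A + B) ^ 3       ≡⟨ cube-* 3 (A + B) ⟨
      (3 * (A + B)) ^ 3      ≤⟨ ^-monoˡ-≤ 3 (subst (3 * (A + B) ≤_) (e a b) (m≤m+n (3 * (A + B)) _)) ⟩
      (2 * (A * B)) ^ 3      ≡⟨ cube-* 2 (A * B) ⟩
      8 * (A * B) ^ 3        ≡⟨ cong (8 *_) (cube-* A B) ⟩
      8 * (A ^ 3 * B ^ 3)    ≤⟨ *-monoʳ-≤ 8 (*-mono-≤ (gap⇒cube≤ ga) (gap⇒cube≤ gb)) ⟩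
      8 * (3 ^ i * 3 ^ j)    ≡⟨ cong (8 *_) (^-distribˡ-+-* 3 i j) ⟨
      8 * 3 ^ (i + j)        ∎)
      where
      open ≤-Reasoning
      A = 3 + a
      B = 3 + b
      e : ∀ a b → 3 * ((3 + a) + (3 + b)) + (2 * (a * b) + 3 * a + 3 * b) ≡ 2 * ((3 + a) * (3 + b))
      e = solve-∀

  gap-plus : ∀ {a b i j} → 0 < a → 0 < b → 0 < i → 0 < j → Gap a i → Gap b j → Gap (a + b) (i + j)
  gap-plus {1} _ b>0 i>0 j>0 ga gb = gap-suc b>0 gb i>0 j>0
  gap-plus {a@(suc (suc _))} {1} {i} {j} a>0 _ i>0 j>0 ga gb =
    subst₂ Gap (+-comm 1 a) (+-comm j i) (gap-suc a>0 ga j>0 i>0)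
  gap-plus {2} {suc (suc b)} _ _ _ _ ga gb = gap-2+ ga gb
  gap-plus {a@(suc (suc (suc _)))} {2} {i} {j} _ _ _ _ ga gb = subst₂ Gap (+-comm 2 a) (+-comm j i) (gap-2+ gb ga)
  gap-plus {suc (suc (suc a))} {suc (suc (suc b))} _ _ _ _ ga gb = gap-3+ ga gb

  gap : ∀ e → Gap (val e) (ones e)
  gap one = slack (from-yes (9 ≤? 24))
  gap (plus e f) = gap-plus (val>0 e) (val>0 f) (ones>0 e) (ones>0 f) (gap e) (gap f)
  gap (times e f) = gap-times (gap e) (gap f)

  cube≤ : ∀ e → val e ^ 3 ≤ 3 ^ ones e
  cube≤ e = gap⇒cube≤ (gap e)

  -- Region s n m says (9/8)(8/9)^s ≤ m³ / 3ⁿ; for n = ‖m‖ the right-hand side is 3 to the power of minus the defect.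
  Region : ℕ → ℕ → ℕ → Set
  Region s n m = 9 * (8 ^ s * 3 ^ n) ≤ 8 * (9 ^ s * m ^ 3)

  -- The leading factor 9/8 puts the bound above 1, the maximal ratio, so the induction on s starts
  -- with nothing to cover.
  region-zero : ∀ {n m} → Gap m n → ¬ Region 0 n m
  region-zero {n} {m} g h = <⇒≱ {8 * 3 ^ n} {9 * 3 ^ n} (m<n+m (8 * 3 ^ n) (m^n>0 3 n)) (begin
    9 * 3 ^ n          ≡⟨ cong (9 *_) (*-identityˡ (3 ^ n)) ⟨
    9 * (1 * 3 ^ n)    ≤⟨ h ⟩
    8 * (1 * m ^ 3)    ≡⟨ cong (8 *_) (*-identityˡ (m ^ 3)) ⟩
    8 * m ^ 3          ≤⟨ *-monoʳ-≤ 8 (gap⇒cube≤ g) ⟩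
    8 * 3 ^ n          ∎)
    where open ≤-Reasoning

  region-pow : ∀ s k {n m} → Region s (3 * k + n) (3 ^ k * m) → Region s n m
  region-pow s k {n} {m} h = *-cancelˡ-≤ (3 ^ (3 * k)) {{m^n≢0 3 (3 * k)}} (begin
    K * (9 * (8 ^ s * 3 ^ n))          ≡⟨ l K (8 ^ s) (3 ^ n) ⟩
    9 * (8 ^ s * (K * 3 ^ n))          ≡⟨ cong (λ x → 9 * (8 ^ s * x)) (^-distribˡ-+-* 3 (3 * k) n) ⟨
    9 * (8 ^ s * 3 ^ (3 * k + n))      ≤⟨ h ⟩
    8 * (9 ^ s * (3 ^ k * m) ^ 3)      ≡⟨ cong (λ x → 8 * (9 ^ s * x)) (cube-* (3 ^ k) m) ⟩
    8 * (9 ^ s * ((3 ^ k) ^ 3 * m ^ 3)) ≡⟨ cong (λ x → 8 * (9 ^ s * (x * m ^ 3))) (cube-pow k) ⟩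
    8 * (9 ^ s * (K * m ^ 3))          ≡⟨ r K (9 ^ s) (m ^ 3) ⟩
    K * (8 * (9 ^ s * m ^ 3))          ∎)
    where
    open ≤-Reasoning
    K = 3 ^ (3 * k)
    l : ∀ a b c → a * (9 * (b * c)) ≡ 9 * (b * (a * c))
    l = solve-∀
    r : ∀ a b c → 8 * (b * (a * c)) ≡ a * (8 * (b * c))
    r = solve-∀

  -- Removing a factor of ratio at most 8/9 improves the ratio of the rest by at least 9/8, which is
  -- one step of s.
  region-times : ∀ s {i j a b} → 9 * b ^ 3 ≤ 8 * 3 ^ j → Region (suc s) (i + j) (a * b) → Region s i a
  region-times s {i} {j} {a} {b} hb h = *-cancelˡ-≤ (8 * 3 ^ j) {{m*n≢0 8 (3 ^ j) {{_}} {{m^n≢0 3 j}}}} (begin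
    8 * 3 ^ j * (9 * (8 ^ s * 3 ^ i))      ≡⟨ l (3 ^ i) (3 ^ j) (8 ^ s) ⟩
    9 * (8 ^ suc s * (3 ^ i * 3 ^ j))      ≡⟨ cong (λ x → 9 * (8 ^ suc s * x)) (^-distribˡ-+-* 3 i j) ⟨
    9 * (8 ^ suc s * 3 ^ (i + j))          ≤⟨ h ⟩
    8 * (9 ^ suc s * (a * b) ^ 3)          ≡⟨ cong (λ x → 8 * (9 ^ suc s * x)) (cube-* a b) ⟩
    8 * (9 ^ suc s * (a ^ 3 * b ^ 3))      ≡⟨ r (a ^ 3) (b ^ 3) (9 ^ s) ⟩
    9 * b ^ 3 * (8 * (9 ^ s * a ^ 3))      ≤⟨ *-monoˡ-≤ (8 * (9 ^ s * a ^ 3)) hb ⟩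
    8 * 3 ^ j * (8 * (9 ^ s * a ^ 3))      ∎)
    where
    open ≤-Reasoning
    l : ∀ x y z → 8 * y * (9 * (z * x)) ≡ 9 * (8 * z * (x * y))
    l = solve-∀
    r : ∀ x y z → 8 * (9 * z * (x * y)) ≡ 9 * y * (8 * (z * x))
    r = solve-∀

  module _ (s : ℕ) {i j a b : ℕ} (a³≤3ⁱ : a ^ 3 ≤ 3 ^ i) (b³≤3ʲ : b ^ 3 ≤ 3 ^ j) (h : Region (suc s) (i + j) (a + b)) where
    private
      open ≤-Reasoning

      pow9 : ∀ u v → 3 ^ u * 9 ^ v ≡ 3 ^ (u + 2 * v)
      pow9 u v = trans (cong (3 ^ u *_) (^-*-assoc 3 2 v)) (sym (^-distribˡ-+-* 3 u (2 * v)))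

      pow-< : ∀ {u v} → 3 ^ u < 3 ^ v → u < v
      pow-< {u} {v} h = ≰⇒> λ v≤u → <⇒≱ h (^-monoʳ-≤ 3 v≤u)

      -- The power 8ˢ is dropped at a loss, so that what remains compares essentially powers of 3.
      region-shape : ∀ {X k} → (a + b) ^ 3 ≤ X * 3 ^ k → 9 * (3 ^ i * 3 ^ j) ≤ 9 ^ suc s * X * 3 ^ k
      region-shape {X} {k} c = *-cancelˡ-≤ 8 (begin
        8 * (9 * (3 ^ i * 3 ^ j))            ≡⟨ cong (λ x → 8 * (9 * x)) (^-distribˡ-+-* 3 i j) ⟨
        8 * (9 * N)                          ≤⟨ m≤m*n (8 * (9 * N)) (8 ^ s) {{m^n≢0 8 s}} ⟩
        8 * (9 * N) * 8 ^ s                  ≡⟨ e N (8 ^ s) ⟩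
        9 * (8 ^ suc s * N)                  ≤⟨ h ⟩
        8 * (9 ^ suc s * (a + b) ^ 3)        ≤⟨ *-monoʳ-≤ 8 (*-monoʳ-≤ (9 ^ suc s) c) ⟩
        8 * (9 ^ suc s * (X * 3 ^ k))        ≡⟨ cong (8 *_) (*-assoc (9 ^ suc s) X (3 ^ k)) ⟨
        8 * (9 ^ suc s * X * 3 ^ k)          ∎)
        where
        N = 3 ^ (i + j)
        e : ∀ x y → 8 * (9 * x) * y ≡ 9 * (8 * y * x)
        e = solve-∀

      sum-cube≤ : ∀ {x y k} → x ≤ y → y ^ 3 ≤ 3 ^ k → (x + y) ^ 3 ≤ 8 * 3 ^ k
      sum-cube≤ {x} {y} {k} x≤y y³≤ = begin
        (x + y) ^ 3  ≤⟨ ^-monoˡ-≤ 3 (+-mono-≤ x≤y (≤-reflexive (sym (+-identityʳ y)))) ⟩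
        (2 * y) ^ 3  ≡⟨ cube-* 2 y ⟩
        8 * y ^ 3    ≤⟨ *-monoʳ-≤ 8 y³≤ ⟩
        8 * 3 ^ k    ∎

    -- Both cubes are at most 3ⁱ, so (a + b)³ ≤ 8·3ⁱ, and the region forces 3ʲ ≤ 8·9ˢ < 9^(s+1). The
    -- summand with fewer ones thus comes from a list depending on s only.
    small-summand : j ≤ i → j < 2 * suc s
    small-summand j≤i = pow-< (*-cancelˡ-< 9 (3 ^ j) (3 ^ (2 * suc s)) (begin-strict
      9 * 3 ^ j            ≤⟨ *-cancelʳ-≤ (9 * 3 ^ j) (9 ^ suc s * 8) (3 ^ i) {{m^n≢0 3 i}}
                                (subst (_≤ 9 ^ suc s * 8 * 3 ^ i) (e (3 ^ i) (3 ^ j)) (region-shape {8} {i} cubes)) ⟩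
      9 ^ suc s * 8        <⟨ *-monoʳ-< (9 ^ suc s) {{m^n≢0 9 (suc s)}} (from-yes (8 <? 9)) ⟩
      9 ^ suc s * 9        ≡⟨ *-comm (9 ^ suc s) 9 ⟩
      9 * 9 ^ suc s        ≡⟨ cong (9 *_) (^-*-assoc 3 2 (suc s)) ⟩
      9 * 3 ^ (2 * suc s)  ∎))
      where
      e : ∀ x y → 9 * (x * y) ≡ 9 * y * x
      e = solve-∀
      cubes : (a + b) ^ 3 ≤ 8 * 3 ^ i
      cubes with ≤-total a b
      ... | inj₁ a≤b = sum-cube≤ {k = i} a≤b (≤-trans b³≤3ʲ (^-monoʳ-≤ 3 j≤i))
      ... | inj₂ b≤a = subst (λ x → x ^ 3 ≤ 8 * 3 ^ i) (+-comm b a) (sum-cube≤ {k = i} b≤a a³≤3ⁱ)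

    private
      -- If a < 3b, then (a + b)³ ≤ 64·3ʲ and the region gives 3ⁱ ≤ 64·9ˢ < 81·9ˢ = 3^(2s+4); this
      -- is the origin of 2s + 4.
      dominant : 2 * s + 4 ≤ i → 3 * b ≤ a
      dominant i≥ = ≮⇒≥ λ a<3b → <⇒≱ (pow-< (*-cancelˡ-< 9 (3 ^ i) (3 ^ (2 * s + 4)) (begin-strict
        9 * 3 ^ i            ≤⟨ *-cancelʳ-≤ (9 * 3 ^ i) (9 ^ suc s * 64) (3 ^ j) {{m^n≢0 3 j}}
                                  (subst (_≤ 9 ^ suc s * 64 * 3 ^ j) (sym (*-assoc 9 (3 ^ i) (3 ^ j)))
                                    (region-shape {64} {j} (cubes (<⇒≤ a<3b)))) ⟩
        9 ^ suc s * 64       <⟨ *-monoʳ-< (9 ^ suc s) {{m^n≢0 9 (suc s)}} (from-yes (64 <? 81)) ⟩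
        9 ^ suc s * 81       ≡⟨ e (9 ^ s) ⟩
        9 * (81 * 9 ^ s)     ≡⟨ cong (9 *_) (pow9 4 s) ⟩
        9 * 3 ^ (4 + 2 * s)  ≡⟨ cong (λ x → 9 * 3 ^ x) (+-comm 4 (2 * s)) ⟩
        9 * 3 ^ (2 * s + 4)  ∎))) i≥
        where
        e : ∀ x → 9 * x * 81 ≡ 9 * (81 * x)
        e = solve-∀
        four : ∀ x → 3 * x + x ≡ 4 * x
        four = solve-∀
        cubes : a ≤ 3 * b → (a + b) ^ 3 ≤ 64 * 3 ^ j
        cubes a≤3b = begin
          (a + b) ^ 3      ≤⟨ ^-monoˡ-≤ 3 (+-monoˡ-≤ b a≤3b) ⟩
          (3 * b + b) ^ 3  ≡⟨ cong (_^ 3) (four b) ⟩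
          (4 * b) ^ 3      ≡⟨ cube-* 4 b ⟩
          64 * b ^ 3       ≤⟨ *-monoʳ-≤ 64 b³≤3ʲ ⟩
          64 * 3 ^ j       ∎

      3∙sum³≤8∙a³ : 3 * b ≤ a → 3 * (a + b) ^ 3 ≤ 8 * a ^ 3
      3∙sum³≤8∙a³ 3b≤a = *-cancelˡ-≤ 9 (begin
        9 * (3 * (a + b) ^ 3)  ≡⟨ *-assoc 9 3 ((a + b) ^ 3) ⟨
        27 * (a + b) ^ 3       ≡⟨ cube-* 3 (a + b) ⟨
        (3 * (a + b)) ^ 3      ≡⟨ cong (_^ 3) (*-distribˡ-+ 3 a b) ⟩
        (3 * a + 3 * b) ^ 3    ≤⟨ ^-monoˡ-≤ 3 (+-monoʳ-≤ (3 * a) 3b≤a) ⟩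
        (3 * a + a) ^ 3        ≡⟨ cong (_^ 3) (four a) ⟩
        (4 * a) ^ 3            ≡⟨ cube-* 4 a ⟩
        64 * a ^ 3             ≤⟨ *-monoˡ-≤ (a ^ 3) (from-yes (64 ≤? 72)) ⟩
        72 * a ^ 3             ≡⟨ *-assoc 9 8 (a ^ 3) ⟩
        9 * (8 * a ^ 3)        ∎)
        where
        four : ∀ x → 3 * x + x ≡ 4 * x
        four = solve-∀

    -- Dropping b loses at most a factor 8/3 in the cube, as a ≥ 3b, and saves at least one 1, worth
    -- a factor 3. The net gain 9/8 is one step of s.
    region-plus : 0 < j → 2 * s + 4 ≤ i → Region s i a
    region-plus j>0 i≥ = *-cancelˡ-≤ 72 (begin
      72 * (9 * (8 ^ s * 3 ^ i))                   ≡⟨ l (8 ^ s) (3 ^ i) ⟩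
      27 * (8 * 8 ^ s * (3 ^ i * 3))               ≤⟨ *-monoʳ-≤ 27 (*-monoʳ-≤ (8 ^ suc s) (*-monoʳ-≤ (3 ^ i) (^-monoʳ-≤ 3 j>0))) ⟩
      27 * (8 ^ suc s * (3 ^ i * 3 ^ j))           ≡⟨ cong (λ x → 27 * (8 ^ suc s * x)) (^-distribˡ-+-* 3 i j) ⟨
      27 * (8 ^ suc s * 3 ^ (i + j))               ≡⟨ *-assoc 3 9 (8 ^ suc s * 3 ^ (i + j)) ⟩
      3 * (9 * (8 ^ suc s * 3 ^ (i + j)))          ≤⟨ *-monoʳ-≤ 3 h ⟩
      3 * (8 * (9 ^ suc s * (a + b) ^ 3))          ≡⟨ m (9 ^ s) ((a + b) ^ 3) ⟩
      72 * 9 ^ s * (3 * (a + b) ^ 3)               ≤⟨ *-monoʳ-≤ (72 * 9 ^ s) (3∙sum³≤8∙a³ (dominant i≥)) ⟩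
      72 * 9 ^ s * (8 * a ^ 3)                     ≡⟨ r (9 ^ s) (a ^ 3) ⟩
      72 * (8 * (9 ^ s * a ^ 3))                   ∎)
      where
      l : ∀ x y → 72 * (9 * (x * y)) ≡ 27 * (8 * x * (y * 3))
      l = solve-∀
      m : ∀ x y → 3 * (8 * (9 * x * y)) ≡ 72 * x * (3 * y)
      m = solve-∀
      r : ∀ x y → 72 * x * (8 * y) ≡ 72 * (8 * (x * y))
      r = solve-∀

  bernoulli : ∀ s → (8 + s) * 8 ^ s ≤ 8 * 9 ^ s
  bernoulli zero = ≤-refl
  bernoulli (suc s) = begin
    (9 + s) * (8 * 8 ^ s)                ≤⟨ m≤m+n _ (s * 8 ^ s) ⟩
    (9 + s) * (8 * 8 ^ s) + s * 8 ^ s    ≡⟨ e s (8 ^ s) ⟩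
    9 * ((8 + s) * 8 ^ s)                ≤⟨ *-monoʳ-≤ 9 (bernoulli s) ⟩
    9 * (8 * 9 ^ s)                      ≡⟨ f (9 ^ s) ⟩
    8 * (9 * 9 ^ s)                      ∎
    where
    open ≤-Reasoning
    e : ∀ s x → (9 + s) * (8 * x) + s * x ≡ 9 * ((8 + s) * x)
    e = solve-∀
    f : ∀ x → 9 * (8 * x) ≡ 8 * (9 * x)
    f = solve-∀

  -- Every bound on 3ⁿ/m³ fits into some region: Bernoulli gives (8/9)ˢ ≤ 8/s, so (9/8)(8/9)ˢ ≤ 1/K
  -- for s = 9K.
  region-of : ∀ K → ∃[ s ] (∀ {n m} → 3 ^ n ≤ K * m ^ 3 → Region s n m)
  region-of K = s , λ {n} {m} h → begin
    9 * (8 ^ s * 3 ^ n)          ≤⟨ *-monoʳ-≤ 9 (*-monoʳ-≤ (8 ^ s) h) ⟩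
    9 * (8 ^ s * (K * m ^ 3))    ≡⟨ e (8 ^ s) K (m ^ 3) ⟩
    s * 8 ^ s * m ^ 3            ≤⟨ *-monoˡ-≤ (m ^ 3) (≤-trans (*-monoˡ-≤ (8 ^ s) (m≤n+m s 8)) (bernoulli s)) ⟩
    8 * 9 ^ s * m ^ 3            ≡⟨ *-assoc 8 (9 ^ s) (m ^ 3) ⟩
    8 * (9 ^ s * m ^ 3)          ∎
    where
    s = 9 * K
    open ≤-Reasoning
    e : ∀ x k y → 9 * (x * (k * y)) ≡ 9 * k * x * y
    e = solve-∀

-- Arithmetic of the fractions m / 3ⁱ

module TernaryFractions where
  open TameSets hiding (<⇒≱; ≤∧≢⇒<)
  open TameConstructions using (*-pos)
  open import Data.Rational as ℚ using (ℚ; 0ℚ; 1ℚ; mkℚ; toℚᵘ)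
  import Data.Rational.Properties as ℚ
  import Data.Rational.Unnormalised as ℚᵘ
  import Data.Rational.Unnormalised.Properties as ℚᵘ
  open import Data.Rational.Solver using (module +-*-Solver)
  open import Data.Integer as ℤ using (+_; +[1+_])
  import Data.Integer.Properties as ℤ
  open import Data.Nat
  open import Data.Nat.Properties

  opaque
    ι : ℕ → ℚ
    ι zero = 0ℚ
    ι (suc n) = 1ℚ ℚ.+ ι n

    third^ : ℕ → ℚ
    third^ zero = 1ℚ
    third^ (suc i) = (+ 1 ℚ./ 3) ℚ.* third^ i

    ι-+ : ∀ m n → ι (m + n) ≡ ι m ℚ.+ ι n
    ι-+ zero n = sym (ℚ.+-identityˡ (ι n))
    ι-+ (suc m) n = trans (cong (1ℚ ℚ.+_) (ι-+ m n)) (sym (ℚ.+-assoc 1ℚ (ι m) (ι n)))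

    ι-* : ∀ m n → ι (m * n) ≡ ι m ℚ.* ι n
    ι-* zero n = sym (ℚ.*-zeroˡ (ι n))
    ι-* (suc m) n = begin
      ι (n + m * n)                  ≡⟨ ι-+ n (m * n) ⟩
      ι n ℚ.+ ι (m * n)              ≡⟨ cong₂ ℚ._+_ (sym (ℚ.*-identityˡ (ι n))) (ι-* m n) ⟩
      1ℚ ℚ.* ι n ℚ.+ ι m ℚ.* ι n     ≡⟨ ℚ.*-distribʳ-+ (ι n) 1ℚ (ι m) ⟨
      (1ℚ ℚ.+ ι m) ℚ.* ι n           ∎
      where open ≡-Reasoning

    ι-nonneg : ∀ n → 0ℚ ℚ.≤ ι n
    ι-nonneg zero = ℚ.≤-refl
    ι-nonneg (suc n) = ℚ.+-mono-≤ (ℚ.nonNegative⁻¹ 1ℚ) (ι-nonneg n)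

    ι-mono-≤ : ∀ {m n} → m ≤ n → ι m ℚ.≤ ι n
    ι-mono-≤ {n = n} z≤n = ι-nonneg n
    ι-mono-≤ (s≤s h) = ℚ.+-monoʳ-≤ 1ℚ (ι-mono-≤ h)

    ι-mono-< : ∀ {m n} → m < n → ι m ℚ.< ι n
    ι-mono-< {m} h = ℚ.<-≤-trans (subst (ℚ._< ι (suc m)) (ℚ.+-identityˡ (ι m)) (ℚ.+-monoˡ-< (ι m) (ℚ.positive⁻¹ 1ℚ))) (ι-mono-≤ h)

    ι-toℚᵘ : ∀ n → toℚᵘ (ι n) ℚᵘ.≃ ℚᵘ.mkℚᵘ (+ n) 0
    ι-toℚᵘ zero = ℚᵘ.≃-refl
    ι-toℚᵘ (suc n) = ℚᵘ.≃-trans (ℚ.toℚᵘ-homo-+ 1ℚ (ι n)) (ℚᵘ.≃-trans (ℚᵘ.+-congʳ (toℚᵘ 1ℚ) (ι-toℚᵘ n))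
      (ℚᵘ.*≡* (cong (ℤ._* + 1) (cong (λ x → + 1 ℤ.+ x) (ℤ.*-identityʳ (+ n))))))

    third>0 : 0ℚ ℚ.< + 1 ℚ./ 3
    third>0 = ℚ.positive⁻¹ (+ 1 ℚ./ 3)

    third^>0 : ∀ i → 0ℚ ℚ.< third^ i
    third^>0 zero = ℚ.positive⁻¹ 1ℚ
    third^>0 (suc i) = *-pos third>0 (third^>0 i)

    third^-+ : ∀ i j → third^ (i + j) ≡ third^ i ℚ.* third^ j
    third^-+ zero j = sym (ℚ.*-identityˡ (third^ j))
    third^-+ (suc i) j = trans (cong ((+ 1 ℚ./ 3) ℚ.*_) (third^-+ i j)) (sym (ℚ.*-assoc (+ 1 ℚ./ 3) (third^ i) (third^ j)))

    ι-zero : ι 0 ≡ 0ℚ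
    ι-zero = refl

    3/3≡1 : ι 3 ℚ.* third^ 1 ≡ 1ℚ
    3/3≡1 = refl

    1/1≡1 : ι 1 ℚ.* third^ 0 ≡ 1ℚ
    1/1≡1 = refl

  -- The denominator of q serves as multiplier: it turns q into its numerator, which is at least 1.
  archimedean : ∀ {q} → 0ℚ ℚ.< q → ∃[ n ] (1ℚ ℚ.≤ ι n ℚ.* q)
  archimedean {q@(mkℚ (+ zero) d c)} q>0 = ⊥-elim (ℚ.<-irrefl (sym (ℚ.↥p≡0⇒p≡0 q refl)) q>0)
  archimedean {mkℚ (ℤ.-[1+ m ]) d c} (ℚ.*<* ())
  archimedean {q@(mkℚ +[1+ m ] d c)} q>0 = suc d , ℚ.toℚᵘ-cancel-≤ (begin
    toℚᵘ 1ℚ                                ≤⟨ ℚᵘ.*≤* (ℤ.+≤+ (s≤s (subst₂ _≤_ (sym (trans (+-identityʳ (d + 0)) (+-identityʳ d))) (sym (*-identityʳ (m + d * suc m)))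
                                                (≤-trans (m≤m*n d (suc m)) (m≤n+m (d * suc m) m))))) ⟩
    ℚᵘ.mkℚᵘ (+ suc d) 0 ℚᵘ.* toℚᵘ q        ≃⟨ ℚᵘ.*-congʳ (ι-toℚᵘ (suc d)) ⟨
    toℚᵘ (ι (suc d)) ℚᵘ.* toℚᵘ q           ≃⟨ ℚ.toℚᵘ-homo-* (ι (suc d)) q ⟨
    toℚᵘ (ι (suc d) ℚ.* q)                 ∎)
    where open ℚᵘ.≤-Reasoning

  infixl 7 _/3^_
  _/3^_ : ℕ → ℕ → ℚ
  m /3^ i = ι m ℚ.* third^ i

  interchange : ∀ a b c d → (a ℚ.* b) ℚ.* (c ℚ.* d) ≡ (a ℚ.* c) ℚ.* (b ℚ.* d)
  interchange = solve 4 (λ a b c d → (a :* b) :* (c :* d) := (a :* c) :* (b :* d)) refl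
    where open +-*-Solver

  /3^-* : ∀ m i n j → (m /3^ i) ℚ.* (n /3^ j) ≡ (m * n) /3^ (i + j)
  /3^-* m i n j = trans (interchange (ι m) (third^ i) (ι n) (third^ j)) (sym (cong₂ ℚ._*_ (ι-* m n) (third^-+ i j)))

  /3^-+ : ∀ m n i → (m /3^ i) ℚ.+ (n /3^ i) ≡ (m + n) /3^ i
  /3^-+ m n i = trans (sym (ℚ.*-distribʳ-+ (third^ i) (ι m) (ι n))) (cong (ℚ._* third^ i) (sym (ι-+ m n)))

  3^k/3^k≡1 : ∀ k → (3 ^ k) /3^ k ≡ 1ℚ
  3^k/3^k≡1 zero = 1/1≡1
  3^k/3^k≡1 (suc k) = trans (sym (/3^-* 3 1 (3 ^ k) k)) (trans (cong₂ ℚ._*_ 3/3≡1 (3^k/3^k≡1 k)) (ℚ.*-identityˡ 1ℚ))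

  /3^-cancel : ∀ k m i → (3 ^ k * m) /3^ (k + i) ≡ m /3^ i
  /3^-cancel k m i = trans (sym (/3^-* (3 ^ k) k m i)) (trans (cong (ℚ._* (m /3^ i)) (3^k/3^k≡1 k)) (ℚ.*-identityˡ (m /3^ i)))

  ι>0 : ∀ {m} → 0 < m → 0ℚ ℚ.< ι m
  ι>0 {m} m>0 = subst (ℚ._< ι m) ι-zero (ι-mono-< m>0)

  /3^>0 : ∀ {m} i → 0 < m → 0ℚ ℚ.< m /3^ i
  /3^>0 i m>0 = *-pos (ι>0 m>0) (third^>0 i)

  /3^-mono-≤ : ∀ {m i n j} → 3 ^ j * m ≤ 3 ^ i * n → m /3^ i ℚ.≤ n /3^ j
  /3^-mono-≤ {m} {i} {n} {j} h = subst₂ ℚ._≤_ (/3^-cancel j m i)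
    (trans (cong ((3 ^ i * n) /3^_) (+-comm j i)) (/3^-cancel i n j))
    (TameConstructions.*-monoʳ-≤ (third^>0 (j + i)) (ι-mono-≤ h))

  /3^-mono-< : ∀ {m i n j} → 3 ^ j * m < 3 ^ i * n → m /3^ i ℚ.< n /3^ j
  /3^-mono-< {m} {i} {n} {j} h = subst₂ ℚ._<_ (/3^-cancel j m i)
    (trans (cong ((3 ^ i * n) /3^_) (+-comm j i)) (/3^-cancel i n j))
    (TameConstructions.*-monoʳ-< (third^>0 (j + i)) (ι-mono-< h))

  /3^-cancel-≤ : ∀ {m i n j} → m /3^ i ℚ.≤ n /3^ j → 3 ^ j * m ≤ 3 ^ i * n
  /3^-cancel-≤ {m} {i} {n} {j} h = ≮⇒≥ λ lt → TameSets.<⇒≱ (/3^-mono-< {n} {j} {m} {i} lt) h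

  /3^-cancel-< : ∀ {m i n j} → m /3^ i ℚ.< n /3^ j → 3 ^ j * m < 3 ^ i * n
  /3^-cancel-< {m} {i} {n} {j} h = ≰⇒> λ le → TameSets.<⇒≱ h (/3^-mono-≤ {n} {j} {m} {i} le)

  /3^-small : ∀ {q} → 0ℚ ℚ.< q → ∀ b → ∃[ i ] (∀ j → i ≤ j → b /3^ j ℚ.< q)
  /3^-small {q} q>0 b with archimedean q>0
  -- As 3ʲ > j ≥ n(b + 1) and nq ≥ 1, the product q·3ʲ is at least b + 1.
  ... | n , 1≤nq = n * suc b , λ j i≤j → TameConstructions.*-cancelʳ-< (ι>0 (m^n>0 3 j)) (begin-strict
    b /3^ j ℚ.* ι (3 ^ j)             ≡⟨ trans (ℚ.*-assoc (ι b) (third^ j) (ι (3 ^ j))) (cong (ι b ℚ.*_) (trans (ℚ.*-comm (third^ j) (ι (3 ^ j))) (3^k/3^k≡1 j))) ⟩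
    ι b ℚ.* 1ℚ                        ≡⟨ ℚ.*-identityʳ (ι b) ⟩
    ι b                               <⟨ ι-mono-< (n<1+n b) ⟩
    ι (suc b)                         ≡⟨ ℚ.*-identityʳ (ι (suc b)) ⟨
    ι (suc b) ℚ.* 1ℚ                  ≤⟨ TameConstructions.*-monoˡ-≤ (ι>0 {suc b} (s≤s z≤n)) 1≤nq ⟩
    ι (suc b) ℚ.* (ι n ℚ.* q)         ≡⟨ rearrange (ι (suc b)) (ι n) q ⟩
    q ℚ.* (ι n ℚ.* ι (suc b))         ≡⟨ cong (q ℚ.*_) (ι-* n (suc b)) ⟨
    q ℚ.* ι (n * suc b)               ≤⟨ TameConstructions.*-monoˡ-≤ q>0 (ι-mono-≤ (≤-trans i≤j (<⇒≤ (n<3^n j)))) ⟩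
    q ℚ.* ι (3 ^ j)                   ∎)
    where
    open ℚ.≤-Reasoning
    rearrange : ∀ a b c → a ℚ.* (b ℚ.* c) ≡ c ℚ.* (b ℚ.* a)
    rearrange = solve 3 (λ a b c → a :* (b :* c) := c :* (b :* a)) refl
      where open +-*-Solver
    n<3^n : ∀ n → n < 3 ^ n
    n<3^n zero = s≤s z≤n
    n<3^n (suc n) = ≤-trans (s≤s (n<3^n n)) (+-mono-≤ (m^n>0 3 n) (m≤m+n (3 ^ n) _))

  gap-small : ∀ {x y} → x ℚ.< y → ∀ b → ∃[ i ] (∀ j → i ≤ j → x ℚ.+ b /3^ j ℚ.< y)
  gap-small {x} {y} x<y b = proj₁ found , λ j i≤j →
    subst (x ℚ.+ b /3^ j ℚ.<_) (cancel x y) (ℚ.+-monoʳ-< x (proj₂ found j i≤j))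
    where
    found : ∃[ i ] (∀ j → i ≤ j → b /3^ j ℚ.< y ℚ.- x)
    found = /3^-small (subst (ℚ._< y ℚ.- x) (ℚ.+-inverseʳ x) (ℚ.+-monoˡ-< (ℚ.- x) x<y)) b
    cancel : ∀ x y → x ℚ.+ (y ℚ.- x) ≡ y
    cancel x y = begin
      x ℚ.+ (y ℚ.- x)    ≡⟨ cong (x ℚ.+_) (ℚ.+-comm y (ℚ.- x)) ⟩
      x ℚ.+ (ℚ.- x ℚ.+ y) ≡⟨ ℚ.+-assoc x (ℚ.- x) y ⟨
      x ℚ.- x ℚ.+ y      ≡⟨ cong (ℚ._+ y) (ℚ.+-inverseʳ x) ⟩
      0ℚ ℚ.+ y           ≡⟨ ℚ.+-identityˡ y ⟩
      y                  ∎
      where open ≡-Reasoning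

-- The closures T and the covering induction

module Closure where
  open import Defs
  open TameSets hiding (<⇒≱; ≤∧≢⇒<)
  open TameConstructions using (tame-*; tame-translates)
  open Complexity
  open TernaryFractions
  open import Data.Rational as ℚ using (ℚ; 0ℚ)
  import Data.Rational.Properties as ℚ
  open import Data.Nat
  open import Data.Nat.Properties
  open import Data.Nat.DivMod using (m≡m%n+[m/n]*n; m%n<n)
  open import Data.Nat.Tactic.RingSolver using (solve-∀)
  open import Data.List using (List; upTo)
  open import Data.List.Membership.Propositional using (lose)
  open import Data.List.Membership.Propositional.Properties using (∈-upTo⁺)
  open import Data.List.Relation.Unary.Any as Any using (Any)
  open import Relation.Nullary.Decidable using (_×-dec_)
  open import Relation.Unary using (_⊆_; _∪_; ∅)

  -- T c d is T_{c-d}, stated without subtraction. Up to order reversal it is the closure of the set of stable defects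
  -- whose complexity is c - d mod 3.
  record T (c d : ℕ) (q : ℚ) : Set where
    constructor rep
    field
      expr   : Expr
      i k    : ℕ
      budget : ones expr + 3 * k + d ≡ c + 3 * i
      value  : q ≡ (3 ^ k * val expr) /3^ i

  private variable
    c d c′ d′ i j k m n : ℕ
    x y q : ℚ

  three : Expr
  three = plus one (plus one one)

  scale : ℕ → Expr → Expr
  scale zero e = e
  scale (suc k) e = times three (scale k e)

  val-scale : ∀ k e → val (scale k e) ≡ 3 ^ k * val e
  val-scale zero e = sym (*-identityˡ (val e))
  val-scale (suc k) e = trans (cong (3 *_) (val-scale k e)) (sym (*-assoc 3 (3 ^ k) (val e)))

  ones-scale : ∀ k e → ones (scale k e) ≡ ones e + 3 * k
  ones-scale zero e = sym (+-identityʳ (ones e))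
  ones-scale (suc k) e = trans (cong (3 +_) (ones-scale k e)) (lemma (ones e) k)
    where
    lemma : ∀ n k → 3 + (n + 3 * k) ≡ n + 3 * suc k
    lemma = solve-∀

  -- The factor 3ᵏ costs exactly what k factors `three` cost. `T` keeps it apart so that `covers`
  -- can move pure factors of a product into it.
  T-integral : T c d q → ∃[ e ] ∃[ i ] (ones e + d ≡ c + 3 * i × q ≡ val e /3^ i)
  T-integral {d = d} (rep e i k budget value) =
    scale k e , i , trans (cong (_+ d) (ones-scale k e)) budget , trans value (cong (_/3^ i) (sym (val-scale k e)))

  T-rep : ∀ e i → ones e + d ≡ c + 3 * i → T c d (val e /3^ i)
  T-rep {d = d} e i b = rep e i 0 (trans (cong (_+ d) (+-identityʳ (ones e))) b)
    (cong (_/3^ i) (sym (*-identityˡ (val e))))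

  T-pos : T c d q → 0ℚ ℚ.< q
  T-pos t with T-integral t
  ... | e , i , _ , refl = /3^>0 i (val>0 e)

  T-raise : ∀ {e} j → ones e + d ≡ c + 3 * i →
            ones (scale j e) + d ≡ c + 3 * (j + i) × val e /3^ i ≡ val (scale j e) /3^ (j + i)
  T-raise {d} {c} {i} {e} j b =
    (begin
      ones (scale j e) + d     ≡⟨ cong (_+ d) (ones-scale j e) ⟩
      ones e + 3 * j + d       ≡⟨ l (ones e) (3 * j) d ⟩
      ones e + d + 3 * j       ≡⟨ cong (_+ 3 * j) b ⟩
      c + 3 * i + 3 * j        ≡⟨ r c i j ⟩
      c + 3 * (j + i)          ∎) ,
    trans (sym (/3^-cancel j (val e) i)) (cong (_/3^ (j + i)) (sym (val-scale j e)))
    where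
    open ≡-Reasoning
    l : ∀ x y z → x + y + z ≡ x + z + y
    l = solve-∀
    r : ∀ c i j → c + 3 * i + 3 * j ≡ c + 3 * (j + i)
    r = solve-∀

  -- Multiplying by `one` spends a unit of budget without changing the value.
  T-weaken : T c (suc d) ⊆ T c d
  T-weaken {c} {d} (rep e i k budget value) = rep (times e one) i k
    (trans (l (ones e) (3 * k) d) budget) (trans value (cong (λ v → (3 ^ k * v) /3^ i) (sym (*-identityʳ (val e)))))
    where
    l : ∀ x y d → x + 1 + y + d ≡ x + y + suc d
    l = solve-∀

  T-weaken-by : ∀ j → T c (d + j) ⊆ T c d
  T-weaken-by {c} {d} zero t = subst (λ d → T c d _) (+-identityʳ d) t
  T-weaken-by {c} {d} (suc j) {q} t = T-weaken-by j (T-weaken (subst (λ d → T c d q) (+-suc d j) t))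

  T-strict : 0 < j → T c (d + j) ⊆ T c (suc d)
  T-strict {suc j} {c} {d} _ {q} t = T-weaken-by j (subst (λ d → T c d q) (+-suc d j) t)

  T-shift : ∀ r → T (r + c) (d + r) ⊆ T c d
  T-shift {c} {d} r (rep e i k budget value) = rep e i k
    (+-cancelʳ-≡ r _ _ (trans (+-assoc (ones e + 3 * k) d r) (trans budget (l r c (3 * i))))) value
    where
    l : ∀ r c x → r + c + x ≡ c + x + r
    l = solve-∀

  T-* : T c d x → T c′ d′ y → T (c + c′) (d + d′) (x ℚ.* y)
  T-* {c} {d} {c′ = c′} {d′} (rep e i k b v) (rep f j l b′ v′) = rep (times e f) (i + j) (k + l)
    (begin
      ones e + ones f + 3 * (k + l) + (d + d′)             ≡⟨ p (ones e) (ones f) k l d d′ ⟩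
      (ones e + 3 * k + d) + (ones f + 3 * l + d′)         ≡⟨ cong₂ _+_ b b′ ⟩
      (c + 3 * i) + (c′ + 3 * j)                           ≡⟨ r c i c′ j ⟩
      c + c′ + 3 * (i + j)                                 ∎)
    (begin
      _                                                    ≡⟨ cong₂ ℚ._*_ v v′ ⟩
      ((3 ^ k * val e) /3^ i) ℚ.* ((3 ^ l * val f) /3^ j)  ≡⟨ /3^-* (3 ^ k * val e) i (3 ^ l * val f) j ⟩
      (3 ^ k * val e * (3 ^ l * val f)) /3^ (i + j)        ≡⟨ cong (_/3^ (i + j)) (s (3 ^ k) (val e) (3 ^ l) (val f)) ⟩
      (3 ^ k * 3 ^ l * (val e * val f)) /3^ (i + j)        ≡⟨ cong (λ x → (x * (val e * val f)) /3^ (i + j)) (^-distribˡ-+-* 3 k l) ⟨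
      (3 ^ (k + l) * (val e * val f)) /3^ (i + j)          ∎)
    where
    open ≡-Reasoning
    p : ∀ a b k l d d′ → a + b + 3 * (k + l) + (d + d′) ≡ (a + 3 * k + d) + (b + 3 * l + d′)
    p = solve-∀
    r : ∀ c i c′ j → (c + 3 * i) + (c′ + 3 * j) ≡ c + c′ + 3 * (i + j)
    r = solve-∀
    s : ∀ a b c d → a * b * (c * d) ≡ a * c * (b * d)
    s = solve-∀

  T-+ : ∀ e f i → ones e + (d + ones f) ≡ c + 3 * i → T c d (val e /3^ i ℚ.+ val f /3^ i)
  T-+ {d} {c} e f i b = subst (T c d) (sym (/3^-+ (val e) (val f) i)) (T-rep (plus e f) i
    (trans (l (ones e) (ones f) d) b))
    where
    l : ∀ a b d → a + b + d ≡ a + (d + b)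
    l = solve-∀

  +-pos : 0ℚ ℚ.< x → 0ℚ ℚ.< y → 0ℚ ℚ.< x ℚ.+ y
  +-pos {x} {y} x>0 y>0 = subst (ℚ._< x ℚ.+ y) (ℚ.+-identityˡ 0ℚ) (ℚ.+-mono-< x>0 y>0)

  -- By the budget equation, val³ / 3^ones equals 3^(d-c)·q³ for every representation of q, so the
  -- region is a lower bound on q. X may also contain points of `T c d` outside the region, which
  -- arise as sums and products of covered points.
  record Cover (s c d : ℕ) : Set₁ where
    field
      {X X′} : ℚSet
      tame   : Tame X X′
      X⊆T    : X ⊆ T c d
      X′⊆T   : X′ ⊆ T c (suc d)
      covers : (t : T c d q) → Region s (ones (T.expr t)) (val (T.expr t)) → X q

  cover-zero : ∀ c d → Cover 0 c d
  cover-zero c d = record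
    { tame = tame-∅ ; X⊆T = λ () ; X′⊆T = λ () ; covers = λ t r → region-zero (gap (T.expr t)) r }

  module Step (s : ℕ) (cover : ∀ c d → Cover s c d) (c d : ℕ) where
    private
      module C c d = Cover (cover c d)

      -- Two summands with at most 2s + 4 ones each, plus room for c and d, which through the budget
      -- equation limit the exponents i and k.
      bound : ℕ
      bound = c + d + ((2 * s + 4) + (2 * s + 4))

      -- The length comes from `small-summand`.
      summands : List Expr
      summands = exprs (2 * suc s)

      Point : Expr → ℕ → ℕ → ℚSet
      Point e i k z = (ones e + 3 * k + d ≡ c + 3 * i) × z ≡ (3 ^ k * val e) /3^ i

      Small : ℚSet
      Small = ⋃ (exprs bound) λ e → ⋃ (upTo (suc bound)) λ i → ⋃ (upTo (suc bound)) λ k → Point e i k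

      module _ (f : Expr) where
        Xf : ℚSet
        Xf = C.X c (d + ones f)

        Stage : ℕ → ℚSet
        Stage i x = Xf x × ∃[ e ] (ones e + (d + ones f) ≡ c + 3 * i × x ≡ val e /3^ i)

        -- A fixed x is representable over 3ⁱ for all large i, so x + val f / 3ⁱ tends to x and the
        -- points x must be adjoined. They have the ones of f to spare, hence lie in `T c (suc d)`.
        Sum : ℚSet
        Sum = Xf ∪ (λ z → ∃[ i ] ∃[ x ] (Stage i x × z ≡ x ℚ.+ val f /3^ i))

        sum-tame : Tame Sum Xf
        sum-tame = tame-translates (C.tame c (d + ones f)) Stage proj₁ mono exhausts
          (λ i → val f /3^ i) (λ i → /3^>0 i (val>0 f)) anti (λ x<y → gap-small x<y (val f)) stage
          where
          mono : ∀ {i j} → i ≤ j → Stage i ⊆ Stage j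
          mono {i} {j} i≤j {x} (Xx , e , b , v) = Xx , scale (j ∸ i) e ,
            subst (λ j → ones e′ + (d + ones f) ≡ c + 3 * j × x ≡ val e′ /3^ j) (m∸n+n≡m i≤j)
              (map₂ (trans v) (T-raise {d + ones f} {c} {i} {e} (j ∸ i) b))
            where e′ = scale (j ∸ i) e
          exhausts : ∀ {x} → Xf x → ∃[ i ] Stage i x
          exhausts Xx with T-integral (C.X⊆T c (d + ones f) Xx)
          ... | e , i , b , v = i , Xx , e , b , v
          anti : ∀ {i j} → i ≤ j → val f /3^ j ℚ.≤ val f /3^ i
          anti {i} {j} i≤j = /3^-mono-≤ {val f} {j} {val f} {i} (*-monoˡ-≤ (val f) (^-monoʳ-≤ 3 i≤j))
          module _ (i : ℕ) where
            Exact : Expr → ℚSet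
            Exact e z = (ones e + (d + ones f) ≡ c + 3 * i × Xf (val e /3^ i)) × z ≡ val e /3^ i ℚ.+ val f /3^ i
            Translate : ℚSet
            Translate z = ∃[ x ] (Stage i x × z ≡ x ℚ.+ val f /3^ i)
            to : ⋃ (exprs (c + 3 * i)) Exact ⊆ Translate
            to p with Any.satisfied p
            ... | e , (b , Xx) , eq = val e /3^ i , (Xx , e , b , refl) , eq
            from : Translate ⊆ ⋃ (exprs (c + 3 * i)) Exact
            from (_ , (Xx , e , b , refl) , eq) = lose (∈-exprs e (≤-trans (m≤m+n (ones e) _) (≤-reflexive b))) ((b , Xx) , eq)
            pos : ∀ e → 0ℚ ℚ.< val e /3^ i ℚ.+ val f /3^ i
            pos e = +-pos (/3^>0 i (val>0 e)) (/3^>0 i (val>0 f))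
            exact : ∀ e → Tame (Exact e) ∅
            exact e = tame-singleton
              (ones e + (d + ones f) ≟ c + 3 * i ×-dec member? (C.tame c (d + ones f)) (val e /3^ i)) (λ _ → pos e)
            stage : Tame Translate ∅
            stage = tame-cong to from (λ p → proj₂ (Any.satisfied p)) (λ ()) (tame-⋃ (exprs (c + 3 * i)) exact)

      -- r is the residue mod 3 of the number of ones in the first factor. Scaling this factor by a
      -- power of 3 leaves it the budget r, and the other factor keeps c - d - r; so three pairs of
      -- sets suffice.
      Product : ℕ → ℚSet
      Product r = Image ℚ._*_ (C.X r 0) (C.X c (d + r))

      Derived-Small : ℚSet
      Derived-Small = ⋃ (exprs bound) λ _ → ⋃ (upTo (suc bound)) λ _ → ⋃ (upTo (suc bound)) λ _ → ∅

      Derived-Product : ℕ → ℚSet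
      Derived-Product r = Image ℚ._*_ (C.X′ r 0) (C.X c (d + r)) ∪ Image ℚ._*_ (C.X r 0) (C.X′ c (d + r))

      small-tame : Tame Small Derived-Small
      small-tame = tame-⋃ (exprs bound) λ e → tame-⋃ (upTo (suc bound)) λ i → tame-⋃ (upTo (suc bound)) λ k →
        tame-singleton (ones e + 3 * k + d ≟ c + 3 * i) λ b → T-pos {c} {d} (rep e i k b refl)

    X X′ : ℚSet
    X  = Small ∪ (⋃ summands Sum ∪ ⋃ (upTo 3) Product)
    X′ = Derived-Small ∪ (⋃ summands Xf ∪ ⋃ (upTo 3) Derived-Product)

    X-tame : Tame X X′
    X-tame = tame-∪ small-tame (tame-∪ (tame-⋃ summands sum-tame)
      (tame-⋃ (upTo 3) λ r → tame-* (C.tame r 0) (C.tame c (d + r))))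

    private
      Xf⊆T : ∀ f → Xf f ⊆ T c (suc d)
      Xf⊆T f x = T-strict (ones>0 f) (C.X⊆T c (d + ones f) x)

      Sum⊆T : ∀ f → Sum f ⊆ T c d
      Sum⊆T f (inj₁ x) = T-weaken (Xf⊆T f x)
      Sum⊆T f (inj₂ (i , _ , (_ , e , b , refl) , refl)) = T-+ e f i b

      Product⊆T : ∀ r → Product r ⊆ T c d
      Product⊆T r (x , y , Xx , Xy , refl) = T-shift r (T-* (C.X⊆T r 0 Xx) (C.X⊆T c (d + r) Xy))

      Derived⊆T : ∀ r → Derived-Product r ⊆ T c (suc d)
      Derived⊆T r (inj₁ (x , y , Xx , Xy , refl)) = T-shift r (T-* (C.X′⊆T r 0 Xx) (C.X⊆T c (d + r) Xy))
      Derived⊆T r (inj₂ (x , y , Xx , Xy , refl)) = T-shift r (T-* (C.X⊆T r 0 Xx) (C.X′⊆T c (d + r) Xy))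

    X⊆T : X ⊆ T c d
    X⊆T (inj₁ p) with Any.satisfied p
    ... | e , p′ with Any.satisfied p′
    ...   | i , p″ with Any.satisfied p″
    ...     | k , b , v = rep e i k b v
    X⊆T (inj₂ (inj₁ p)) = let f , x = Any.satisfied p in Sum⊆T f x
    X⊆T (inj₂ (inj₂ p)) = let f , x = Any.satisfied p in Product⊆T f x

    X′⊆T : X′ ⊆ T c (suc d)
    X′⊆T (inj₁ p) = ⊥-elim (proj₂ (Any.satisfied (proj₂ (Any.satisfied (proj₂ (Any.satisfied p))))))
    X′⊆T (inj₂ (inj₁ p)) = let f , x = Any.satisfied p in Xf⊆T f x
    X′⊆T (inj₂ (inj₂ p)) = let f , x = Any.satisfied p in Derived⊆T f x

    private
      -- Common powers of 3 are cancelled. A `multiple` has all its ones paid by c, so there are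
      -- finitely many; a `fraction` has no factor 3ᵏ in front and can be split along a sum.
      data Reduced (e : Expr) (q : ℚ) : Set where
        fraction : ∀ i → ones e + d ≡ c + 3 * i → q ≡ val e /3^ i → Reduced e q
        multiple : ∀ k → ones e + 3 * k + d ≡ c → q ≡ (3 ^ k * val e) /3^ 0 → Reduced e q

      reduce : ∀ e i k → ones e + 3 * k + d ≡ c + 3 * i → q ≡ (3 ^ k * val e) /3^ i → Reduced e q
      reduce e i k b v with ≤-total k i
      ... | inj₁ k≤i with m≤n⇒∃[o]m+o≡n k≤i
      ...   | o , refl = fraction o
                (+-cancelʳ-≡ (3 * k) _ _ (trans (l (ones e) d (3 * k)) (trans b (r c k o))))
                (trans v (/3^-cancel k (val e) o))
        where
        l : ∀ n d x → n + d + x ≡ n + x + d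
        l = solve-∀
        r : ∀ c k o → c + 3 * (k + o) ≡ c + 3 * o + 3 * k
        r = solve-∀
      reduce {q} e i k b v | inj₂ i≤k with m≤n⇒∃[o]m+o≡n i≤k
      ...   | o , refl = multiple o
                (+-cancelʳ-≡ (3 * i) _ _ (trans (l (ones e) o i d) b))
                (begin
                  q                                           ≡⟨ v ⟩
                  (3 ^ (i + o) * val e) /3^ i                 ≡⟨ cong₂ _/3^_ (cong (_* val e) (^-distribˡ-+-* 3 i o)) (sym (+-identityʳ i)) ⟩
                  (3 ^ i * 3 ^ o * val e) /3^ (i + 0)         ≡⟨ cong (_/3^ (i + 0)) (*-assoc (3 ^ i) (3 ^ o) (val e)) ⟩
                  (3 ^ i * (3 ^ o * val e)) /3^ (i + 0)       ≡⟨ /3^-cancel i (3 ^ o * val e) 0 ⟩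
                  (3 ^ o * val e) /3^ 0                       ∎)
        where
        open ≡-Reasoning
        l : ∀ n o i d → n + 3 * o + d + 3 * i ≡ n + 3 * (i + o) + d
        l = solve-∀

      small : ∀ e i k → ones e ≤ bound → i ≤ bound → k ≤ bound →
              ones e + 3 * k + d ≡ c + 3 * i → q ≡ (3 ^ k * val e) /3^ i → Small q
      small e i k e≤ i≤ k≤ b v = lose (∈-exprs e e≤) (lose (∈-upTo⁺ (s≤s i≤)) (lose (∈-upTo⁺ (s≤s k≤)) (b , v)))

      N : ℕ
      N = 2 * s + 4

      c≤bound : c ≤ bound
      c≤bound = ≤-trans (m≤m+n c d) (m≤m+n (c + d) (N + N))

      small-fraction : ∀ e i → ones e ≤ N + N → ones e + d ≡ c + 3 * i → q ≡ val e /3^ i → Small q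
      small-fraction e i e≤ b v = small e i 0 (≤-trans e≤ (m≤n+m (N + N) (c + d))) i≤ z≤n
        (trans (cong (_+ d) (+-identityʳ (ones e))) b) (trans v (cong (_/3^ i) (sym (*-identityˡ (val e)))))
        where
        open ≤-Reasoning
        i≤ : i ≤ bound
        i≤ = begin
          i                  ≤⟨ m≤n*m i 3 ⟩
          3 * i              ≤⟨ m≤n+m (3 * i) c ⟩
          c + 3 * i          ≡⟨ b ⟨
          ones e + d         ≤⟨ +-monoˡ-≤ d e≤ ⟩
          N + N + d          ≤⟨ m≤n+m (N + N + d) c ⟩
          c + (N + N + d)    ≡⟨ cong (c +_) (+-comm (N + N) d) ⟩
          c + (d + (N + N))  ≡⟨ +-assoc c d (N + N) ⟨
          bound              ∎

      small-multiple : ∀ e k → ones e + 3 * k + d ≡ c → q ≡ (3 ^ k * val e) /3^ 0 → Small q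
      small-multiple e k b v = small e 0 k (≤-trans (≤-trans (m≤m+n (ones e) (3 * k)) n+3k≤c) c≤bound) z≤n
        (≤-trans (≤-trans (m≤n*m k 3) (≤-trans (m≤n+m (3 * k) (ones e)) n+3k≤c)) c≤bound)
        (trans b (sym (+-identityʳ c))) v
        where
        n+3k≤c : ones e + 3 * k ≤ c
        n+3k≤c = ≤-trans (m≤m+n (ones e + 3 * k) d) (≤-reflexive b)

      covers-sum : ∀ e f i → ones e + ones f + d ≡ c + 3 * i → q ≡ (val e + val f) /3^ i →
                   Region (suc s) (ones e + ones f) (val e + val f) → ones f ≤ ones e → N ≤ ones e →
                   ⋃ summands Sum q
      covers-sum {q} e f i b v reg f≤e N≤e = lose
        (∈-exprs f (<⇒≤ (small-summand s {a = val e} {val f} (cube≤ e) (cube≤ f) reg f≤e)))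
        (inj₂ (i , val e /3^ i , (C.covers c (d + ones f) (T-rep e i b′) (region-plus s {a = val e} {val f} (cube≤ e) (cube≤ f) reg (ones>0 f) N≤e) , e , b′ , refl) ,
               trans v (sym (/3^-+ (val e) (val f) i))))
        where
        b′ : ones e + (d + ones f) ≡ c + 3 * i
        b′ = trans (l (ones e) (ones f) d) b
          where
          l : ∀ x y z → x + (z + y) ≡ x + y + z
          l = solve-∀

      covers-plus : ∀ e f i k → ones e + ones f + 3 * k + d ≡ c + 3 * i → q ≡ (3 ^ k * (val e + val f)) /3^ i →
                    Region (suc s) (ones e + ones f) (val e + val f) → X q
      covers-plus {q} e f i k b v reg with reduce (plus e f) i k b v
      ... | multiple k′ b′ v′ = inj₁ (small-multiple (plus e f) k′ b′ v′)
      ... | fraction i′ b′ v′ with ≤-total (ones f) (ones e) | N ≤? ones e | N ≤? ones f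
      -- If the larger summand has at least N ones, the induction hypothesis applies to it.
      -- Otherwise both summands are short and the fraction is in the finite list.
      ...   | inj₁ f≤e | yes N≤e | _ = inj₂ (inj₁ (covers-sum e f i′ b′ v′ reg f≤e N≤e))
      ...   | inj₂ e≤f | _ | yes N≤f = inj₂ (inj₁ (covers-sum f e i′
                (trans (cong (_+ d) (+-comm (ones f) (ones e))) b′)
                (trans v′ (cong (_/3^ i′) (+-comm (val e) (val f))))
                (subst₂ (Region (suc s)) (+-comm (ones e) (ones f)) (+-comm (val e) (val f)) reg) e≤f N≤f))
      ...   | inj₁ f≤e | no N≰e | _ = inj₁ (small-fraction (plus e f) i′
                (+-mono-≤ (<⇒≤ (≰⇒> N≰e)) (≤-trans f≤e (<⇒≤ (≰⇒> N≰e)))) b′ v′)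
      ...   | inj₂ e≤f | _ | no N≰f = inj₁ (small-fraction (plus e f) i′
                (+-mono-≤ (≤-trans e≤f (<⇒≤ (≰⇒> N≰f))) (<⇒≤ (≰⇒> N≰f))) b′ v′)

      covers-slack : ∀ e f i k → 9 * val e ^ 3 ≤ 8 * 3 ^ ones e → 9 * val f ^ 3 ≤ 8 * 3 ^ ones f →
                     ones e + ones f + 3 * k + d ≡ c + 3 * i → q ≡ (3 ^ k * (val e * val f)) /3^ i →
                     Region (suc s) (ones e + ones f) (val e * val f) → ⋃ (upTo 3) Product q
      covers-slack {q} e f i k he hf b v reg = lose (∈-upTo⁺ (m%n<n (ones e) 3))
        -- The first factor is divided by 3ᵗ to reach the budget r; the second is multiplied by 3ᵗ
        -- in compensation.
        ( val e /3^ t , (3 ^ (k + t) * val f) /3^ i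
        , C.covers r 0 (T-rep e t be) (region-times s {ones e} {ones f} {val e} {val f} hf reg)
        , C.covers c (d + r) (rep f i (k + t) bf refl)
            (region-times s {ones f} {ones e} {val f} {val e} he
              (subst₂ (Region (suc s)) (+-comm (ones e) (ones f)) (*-comm (val e) (val f)) reg))
        , trans v (sym value))
        where
        r = ones e % 3
        t = ones e / 3
        n≡ : ones e ≡ r + 3 * t
        n≡ = trans (m≡m%n+[m/n]*n (ones e) 3) (cong (r +_) (*-comm t 3))
        be : ones e + 0 ≡ r + 3 * t
        be = trans (+-identityʳ (ones e)) n≡
        bf : ones f + 3 * (k + t) + (d + r) ≡ c + 3 * i
        bf = trans (l (ones f) k t d r) (trans (cong (λ n → n + ones f + 3 * k + d) (sym n≡)) b)
          where
          l : ∀ n k t d r → n + 3 * (k + t) + (d + r) ≡ r + 3 * t + n + 3 * k + d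
          l = solve-∀
        value : (val e /3^ t) ℚ.* ((3 ^ (k + t) * val f) /3^ i) ≡ (3 ^ k * (val e * val f)) /3^ i
        value = begin
          (val e /3^ t) ℚ.* ((3 ^ (k + t) * val f) /3^ i)     ≡⟨ /3^-* (val e) t (3 ^ (k + t) * val f) i ⟩
          (val e * (3 ^ (k + t) * val f)) /3^ (t + i)         ≡⟨ cong (λ x → (val e * (x * val f)) /3^ (t + i)) (^-distribˡ-+-* 3 k t) ⟩
          (val e * (3 ^ k * 3 ^ t * val f)) /3^ (t + i)       ≡⟨ cong (_/3^ (t + i)) (l (val e) (3 ^ k) (3 ^ t) (val f)) ⟩
          (3 ^ t * (3 ^ k * (val e * val f))) /3^ (t + i)     ≡⟨ /3^-cancel t (3 ^ k * (val e * val f)) i ⟩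
          (3 ^ k * (val e * val f)) /3^ i                     ∎
          where
          open ≡-Reasoning
          l : ∀ e k t f → e * (k * t * f) ≡ t * (k * (e * f))
          l = solve-∀

    -- The recursion on the expression stays at the same s and passes only through pure factors:
    -- they have ratio 1, so by `region-pow` the other factor stays in the region. All other cases
    -- use the covers for s.
    covers : ∀ e i k → ones e + 3 * k + d ≡ c + 3 * i → q ≡ (3 ^ k * val e) /3^ i →
             Region (suc s) (ones e) (val e) → X q
    covers one i k b v reg with reduce one i k b v
    ... | fraction i′ b′ v′ = inj₁ (small-fraction one i′ (≤-trans (s≤s z≤n) (≤-trans (m≤n+m 4 (2 * s)) (m≤m+n N N))) b′ v′)
    ... | multiple k′ b′ v′ = inj₁ (small-multiple one k′ b′ v′)
    covers (plus e f) i k b v reg = covers-plus e f i k b v reg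
    covers (times e f) i k b v reg with gap e | gap f
    ... | pure l m≡ n≡ | _ = covers f i (k + l)
            (trans (p (ones f) k l d) (trans (cong (λ n → n + ones f + 3 * k + d) (sym n≡)) b))
            (trans v (cong (_/3^ i) (trans (cong (λ m → 3 ^ k * (m * val f)) m≡) (r k l (val f)))))
            (region-pow (suc s) l (subst₂ (Region (suc s)) (cong (_+ ones f) n≡) (cong (_* val f) m≡) reg))
      where
      p : ∀ n k l d → n + 3 * (k + l) + d ≡ 3 * l + n + 3 * k + d
      p = solve-∀
      r : ∀ k l m → 3 ^ k * (3 ^ l * m) ≡ 3 ^ (k + l) * m
      r k l m = trans (sym (*-assoc (3 ^ k) (3 ^ l) m)) (cong (_* m) (sym (^-distribˡ-+-* 3 k l)))
    ... | slack _ | pure l m≡ n≡ = covers e i (k + l)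
            (trans (p (ones e) k l d) (trans (cong (λ n → ones e + n + 3 * k + d) (sym n≡)) b))
            (trans v (cong (_/3^ i) (trans (cong (λ m → 3 ^ k * (val e * m)) m≡) (r k l (val e)))))
            (region-pow (suc s) l (subst₂ (Region (suc s))
              (trans (cong (ones e +_) n≡) (+-comm (ones e) (3 * l)))
              (trans (cong (val e *_) m≡) (*-comm (val e) (3 ^ l))) reg))
      where
      p : ∀ n k l d → n + 3 * (k + l) + d ≡ n + 3 * l + 3 * k + d
      p = solve-∀
      r : ∀ k l m → 3 ^ k * (m * 3 ^ l) ≡ 3 ^ (k + l) * m
      r k l m = trans (cong (3 ^ k *_) (*-comm m (3 ^ l))) (trans (sym (*-assoc (3 ^ k) (3 ^ l) m))
                  (cong (_* m) (sym (^-distribˡ-+-* 3 k l))))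
    ... | slack he | slack hf = inj₂ (inj₂ (covers-slack e f i k he hf b v reg))

  cover : ∀ s c d → Cover s c d
  cover zero = cover-zero
  cover (suc s) c d = record
    { tame = X-tame ; X⊆T = X⊆T ; X′⊆T = X′⊆T ; covers = λ { (rep e i k b v) → covers e i k b v } }
    where open Step s (cover s) c d

-- Order structure of T, obtained from the covers

module ClosureOrder where
  open import Defs
  open TameSets hiding (<⇒≱; ≤∧≢⇒<)
  open Complexity
  open TernaryFractions
  open Closure using (T; rep; T-integral; T-rep; T-raise; scale; cover; Cover)
  open import Data.Rational as ℚ using (ℚ; 0ℚ)
  import Data.Rational.Properties as ℚ
  open import Data.Nat
  open import Data.Nat.Properties
  open import Data.Nat.Tactic.RingSolver using (solve-∀)
  open import Induction.WellFounded using (Acc)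
  open import Relation.Nullary.Decidable using (map′)

  private variable
    c d : ℕ
    q y : ℚ

  cube-cancel-≤ : ∀ {x y} → x ^ 3 ≤ y ^ 3 → x ≤ y
  cube-cancel-≤ {x} {y} h = ≮⇒≥ λ y<x → <⇒≱ (^-monoˡ-< 3 y<x) h

  cube-cancel-< : ∀ {x y} → x ^ 3 < y ^ 3 → x < y
  cube-cancel-< h = ≰⇒> λ y≤x → <⇒≱ h (^-monoˡ-≤ 3 y≤x)

  pow-scaled : ∀ k m → (3 ^ k * m) ^ 3 ≡ 3 ^ (3 * k) * m ^ 3
  pow-scaled k m = trans (cube-* (3 ^ k) m) (cong (_* m ^ 3) (cube-pow k))

  -- With denominators cleared this is q³ ≤ 3^(c-d), which combines `cube≤` with the budget
  -- equation.
  T-ceiling : (t : T c d q) → (3 ^ T.k t * val (T.expr t)) ^ 3 * 3 ^ d ≤ 3 ^ (c + 3 * T.i t)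
  T-ceiling {c} {d} (rep e i k b v) = begin
    (3 ^ k * val e) ^ 3 * 3 ^ d            ≡⟨ cong (_* 3 ^ d) (pow-scaled k (val e)) ⟩
    3 ^ (3 * k) * val e ^ 3 * 3 ^ d        ≤⟨ *-monoˡ-≤ (3 ^ d) (*-monoʳ-≤ (3 ^ (3 * k)) (cube≤ e)) ⟩
    3 ^ (3 * k) * 3 ^ ones e * 3 ^ d       ≡⟨ cong (_* 3 ^ d) (^-distribˡ-+-* 3 (3 * k) (ones e)) ⟨
    3 ^ (3 * k + ones e) * 3 ^ d           ≡⟨ ^-distribˡ-+-* 3 (3 * k + ones e) d ⟨
    3 ^ (3 * k + ones e + d)               ≡⟨ cong (λ x → 3 ^ (x + d)) (+-comm (3 * k) (ones e)) ⟩
    3 ^ (ones e + 3 * k + d)               ≡⟨ cong (3 ^_) b ⟩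
    3 ^ (c + 3 * i)                        ∎
    where open ≤-Reasoning

  -- The budget equation makes val³ / 3^(ones + d) equal to q³ / 3ᶜ, so a lower bound on q gives one
  -- that is uniform over all representations.
  T-floor : ∀ u (t : T c d q) → 1 /3^ u ℚ.≤ q → 3 ^ (ones (T.expr t) + d) ≤ 3 ^ (c + 3 * u) * val (T.expr t) ^ 3
  T-floor {c} {d} u (rep e i k b refl) h = *-cancelˡ-≤ (3 ^ (3 * k)) {{m^n≢0 3 (3 * k)}} (begin
    3 ^ (3 * k) * 3 ^ (ones e + d)                        ≡⟨ ^-distribˡ-+-* 3 (3 * k) (ones e + d) ⟨
    3 ^ (3 * k + (ones e + d))                            ≡⟨ cong (3 ^_) (trans (l (3 * k) (ones e) d) b) ⟩
    3 ^ (c + 3 * i)                                       ≡⟨ ^-distribˡ-+-* 3 c (3 * i) ⟩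
    3 ^ c * 3 ^ (3 * i)                                   ≡⟨ cong (3 ^ c *_) (cube-pow i) ⟨
    3 ^ c * (3 ^ i) ^ 3                                   ≤⟨ *-monoʳ-≤ (3 ^ c) (^-monoˡ-≤ 3 3ⁱ≤) ⟩
    3 ^ c * (3 ^ u * (3 ^ k * val e)) ^ 3                 ≡⟨ cong (3 ^ c *_) (pow-scaled u (3 ^ k * val e)) ⟩
    3 ^ c * (3 ^ (3 * u) * (3 ^ k * val e) ^ 3)           ≡⟨ cong (λ x → 3 ^ c * (3 ^ (3 * u) * x)) (pow-scaled k (val e)) ⟩
    3 ^ c * (3 ^ (3 * u) * (3 ^ (3 * k) * val e ^ 3))     ≡⟨ r (3 ^ c) (3 ^ (3 * u)) (3 ^ (3 * k)) (val e ^ 3) ⟩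
    3 ^ (3 * k) * (3 ^ c * 3 ^ (3 * u) * val e ^ 3)       ≡⟨ cong (λ x → 3 ^ (3 * k) * (x * val e ^ 3)) (^-distribˡ-+-* 3 c (3 * u)) ⟨
    3 ^ (3 * k) * (3 ^ (c + 3 * u) * val e ^ 3)           ∎)
    where
    open ≤-Reasoning
    3ⁱ≤ : 3 ^ i ≤ 3 ^ u * (3 ^ k * val e)
    3ⁱ≤ = subst (_≤ 3 ^ u * (3 ^ k * val e)) (*-identityʳ (3 ^ i)) (/3^-cancel-≤ {1} {u} {3 ^ k * val e} {i} h)
    l : ∀ x n d → x + (n + d) ≡ n + x + d
    l = solve-∀
    r : ∀ c u k m → c * (u * (k * m)) ≡ k * (c * u * m)
    r = solve-∀

  module _ (c d u : ℕ) where
    private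
      K : ℕ
      K = 3 ^ (c + 3 * u)

    covering : Cover (proj₁ (region-of K)) c d
    covering = cover (proj₁ (region-of K)) c d

    module Covering = Cover covering

    T⊆X : T c d q → 1 /3^ u ℚ.≤ q → Covering.X q
    T⊆X t h = Covering.covers t (proj₂ (region-of K) {ones (T.expr t)} {val (T.expr t)}
      (≤-trans (^-monoʳ-≤ 3 (m≤m+n (ones (T.expr t)) d)) (T-floor u t h)))

  -- The number 1 at an arbitrary positive cost: `T` demands the budget as an equality, so surplus
  -- ones have to be burnt.
  units : ℕ → Expr
  units zero = one
  units (suc n) = times one (units n)

  val-units : ∀ n → val (units n) ≡ 1
  val-units zero = refl
  val-units (suc n) = trans (+-identityʳ (val (units n))) (val-units n)

  ones-units : ∀ n → ones (units n) ≡ suc n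
  ones-units zero = refl
  ones-units (suc n) = cong suc (ones-units n)

  T-tiny : ∀ i → suc d ≤ i → T c d (1 /3^ i)
  T-tiny {d} {c} i d<i with m≤n⇒∃[o]m+o≡n (≤-trans d<i (≤-trans (m≤n*m i 3) (m≤n+m (3 * i) c)))
  ... | o , eq = subst (λ v → T c d (v /3^ i)) (val-units o) (T-rep (units o) i
    (trans (cong (_+ d) (ones-units o)) (trans (cong suc (+-comm o d)) eq)))

  threshold : 0ℚ ℚ.< q → ∃[ u ] (1 /3^ u ℚ.< q)
  threshold q>0 = proj₁ (/3^-small q>0 1) , proj₂ (/3^-small q>0 1) _ ≤-refl

  T-below : 0ℚ ℚ.< q → GreatestBelow (T c d) q
  T-below {q} {c} {d} q>0 = from-cover (Tame.below tame q)
    where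
    -- For this u, 1/3ᵘ is below q and itself in `T c d`. So the cover has a point below q, and
    -- whatever lies under the cutoff 1/3ᵘ is dominated by the maximum found.
    u = proj₁ (/3^-small q>0 1) ⊔ suc d
    open Covering c d u
    1/3ᵘ<q : 1 /3^ u ℚ.< q
    1/3ᵘ<q = proj₂ (/3^-small q>0 1) u (m≤m⊔n _ (suc d))
    tiny : X (1 /3^ u)
    tiny = T⊆X c d u (T-tiny u (m≤n⊔m (proj₁ (/3^-small q>0 1)) (suc d))) ℚ.≤-refl
    from-cover : Sup X q → GreatestBelow (T c d) q
    from-cover (inj₁ none) = ⊥-elim (TameSets.<⇒≱ 1/3ᵘ<q (none tiny))
    from-cover (inj₂ (greatest p Xp p<q max)) = greatest p (X⊆T Xp) p<q λ {x} t x<q →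
      [ (λ h → max (T⊆X c d u t h) x<q) , (λ h → ℚ.≤-trans h (max tiny 1/3ᵘ<q)) ]′ (ℚ.≤-total (1 /3^ u) x)

  -- With 1/3ᵘ < q, cover and `T c d` agree beyond q, so the infimum carries over.
  T-above : 0ℚ ℚ.< q → Inf (T c (suc d)) (T c d) q
  T-above {q} {c} {d} q>0 = inf-weaken X′⊆T (inf-cong X⊆T
    (λ t q<x → T⊆X c d u t (ℚ.<⇒≤ (ℚ.<-trans (proj₂ (threshold q>0)) q<x))) (Tame.above tame q q>0))
    where
    u = proj₁ (threshold q>0)
    open Covering c d u

  T-member : 0ℚ ℚ.< q → Dec (T c d q)
  T-member {q} {c} {d} q>0 = map′ X⊆T (λ t → T⊆X c d u t (ℚ.<⇒≤ (proj₂ (threshold q>0)))) (member? tame q)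
    where
    u = proj₁ (threshold q>0)
    open Covering c d u

  T-wf : 0ℚ ℚ.< q → Acc (Above (T c d)) q
  T-wf {q} {c} {d} q>0 = acc-mono
    (λ t q<x → T⊆X c d u t (ℚ.<⇒≤ (ℚ.<-trans (proj₂ (threshold q>0)) q<x))) ℚ.≤-refl (Tame.wf tame q)
    where
    u = proj₁ (threshold q>0)
    open Covering c d u

  -- The extra unit of budget pays for adding 1/3ʲ, for every large j.
  T-limit : T c (suc d) q → q ℚ.< y → ∃[ r ] (T c d r × q ℚ.< r × r ℚ.< y)
  T-limit {c} {d} {q} {y} t q<y with T-integral t
  ... | e , i , b , v = q ℚ.+ 1 /3^ j , subst (T c d) (sym value) (T-rep (plus (scale u e) one) j budget) , q<r ,
    proj₂ (gap-small q<y 1) j (m≤m+n u i)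
    where
    u = proj₁ (gap-small q<y 1)
    j = u + i
    q<r : q ℚ.< q ℚ.+ 1 /3^ j
    q<r = subst (ℚ._< q ℚ.+ 1 /3^ j) (ℚ.+-identityʳ q) (ℚ.+-monoʳ-< q (/3^>0 j (s≤s z≤n)))
    raised : ones (scale u e) + suc d ≡ c + 3 * (u + i) × val e /3^ i ≡ val (scale u e) /3^ (u + i)
    raised = T-raise {suc d} {c} {i} {e} u b
    budget : ones (scale u e) + 1 + d ≡ c + 3 * j
    budget = trans (+-assoc (ones (scale u e)) 1 d) (proj₁ raised)
    value : q ℚ.+ 1 /3^ j ≡ (val (scale u e) + 1) /3^ j
    value = trans (cong (ℚ._+ 1 /3^ j) (trans v (proj₂ raised))) (/3^-+ (val (scale u e)) 1 j)

  -- Each unit of d lowers the ceiling on q³ by a factor 3; for q ≥ 3^(-u) this leaves d ≤ c + 3u.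
  T-finite : 0ℚ ℚ.< q → ∃[ d ] ¬ T c d q
  T-finite {q} {c} q>0 = suc (c + 3 * u) , λ t → <⇒≱ (exceeds t) (begin
    3 ^ (ones (T.expr t) + suc (c + 3 * u))             ≤⟨ T-floor u t (ℚ.<⇒≤ (proj₂ (threshold q>0))) ⟩
    3 ^ (c + 3 * u) * val (T.expr t) ^ 3                ≤⟨ *-monoʳ-≤ (3 ^ (c + 3 * u)) (cube≤ (T.expr t)) ⟩
    3 ^ (c + 3 * u) * 3 ^ ones (T.expr t)               ≡⟨ ^-distribˡ-+-* 3 (c + 3 * u) (ones (T.expr t)) ⟨
    3 ^ (c + 3 * u + ones (T.expr t))                   ∎)
    where
    open ≤-Reasoning
    u = proj₁ (threshold q>0)
    exceeds : (t : T c (suc (c + 3 * u)) q) → 3 ^ (c + 3 * u + ones (T.expr t)) < 3 ^ (ones (T.expr t) + suc (c + 3 * u))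
    exceeds t = ^-monoʳ-< 3 (s≤s (s≤s z≤n)) (≤-reflexive (trans (cong suc (+-comm (c + 3 * u) n)) (sym (+-suc n (c + 3 * u)))))
      where n = ones (T.expr t)

  T-bounded : T c d q → q ℚ.< suc (3 ^ c) /3^ 0
  T-bounded {c} {d} t@(rep e i k b refl) = /3^-mono-< {3 ^ k * val e} {i} {suc (3 ^ c)} {0} (begin-strict
    3 ^ 0 * (3 ^ k * val e)   ≡⟨ *-identityˡ (3 ^ k * val e) ⟩
    3 ^ k * val e             ≤⟨ cube-cancel-≤ cubes ⟩
    3 ^ i * 3 ^ c             <⟨ *-monoʳ-< (3 ^ i) {{m^n≢0 3 i}} (n<1+n (3 ^ c)) ⟩
    3 ^ i * suc (3 ^ c)       ∎)
    where
    open ≤-Reasoning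
    cubes : (3 ^ k * val e) ^ 3 ≤ (3 ^ i * 3 ^ c) ^ 3
    cubes = begin
      (3 ^ k * val e) ^ 3            ≤⟨ m≤m*n ((3 ^ k * val e) ^ 3) (3 ^ d) {{m^n≢0 3 d}} ⟩
      (3 ^ k * val e) ^ 3 * 3 ^ d    ≤⟨ T-ceiling t ⟩
      3 ^ (c + 3 * i)                ≤⟨ ^-monoʳ-≤ 3 (+-monoˡ-≤ (3 * i) (m≤n*m c 3)) ⟩
      3 ^ (3 * c + 3 * i)            ≡⟨ cong (3 ^_) (l c i) ⟩
      3 ^ (3 * (i + c))              ≡⟨ cube-pow (i + c) ⟨
      (3 ^ (i + c)) ^ 3              ≡⟨ cong (_^ 3) (^-distribˡ-+-* 3 i c) ⟩
      (3 ^ i * 3 ^ c) ^ 3            ∎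
      where
      l : ∀ c i → 3 * c + 3 * i ≡ 3 * (i + c)
      l = solve-∀

  T-top : ∃[ p ] (T c d p × (∀ {x} → T c d x → x ℚ.≤ p))
  T-top {c} {d} with T-below {suc (3 ^ c) /3^ 0} {c} {d} (/3^>0 0 (s≤s z≤n))
  ... | greatest p Tp _ max = p , Tp , λ t → max t (T-bounded t)

  -- For d = c + 3u the ceiling q³ ≤ 3^(c-d) reads q ≤ 1/3ᵘ. Since `T-power` attains it, the defect
  -- bound c + 3u becomes the greatest point of a derived set.
  T-max : ∀ u {x} → T c (c + 3 * u) x → x ℚ.≤ 1 /3^ u
  T-max {c} u t@(rep e i k b refl) = /3^-mono-≤ {3 ^ k * val e} {i} {1} {u} (cube-cancel-≤ (begin
    (3 ^ u * (3 ^ k * val e)) ^ 3                ≡⟨ pow-scaled u (3 ^ k * val e) ⟩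
    3 ^ (3 * u) * (3 ^ k * val e) ^ 3            ≤⟨ *-cancelˡ-≤ (3 ^ c) {{m^n≢0 3 c}} scaled ⟩
    3 ^ (3 * i)                                  ≡⟨ cube-pow i ⟨
    (3 ^ i) ^ 3                                  ≡⟨ cong (_^ 3) (*-identityʳ (3 ^ i)) ⟨
    (3 ^ i * 1) ^ 3                              ∎))
    where
    open ≤-Reasoning
    l : ∀ x y z → x * (y * z) ≡ z * (x * y)
    l = solve-∀
    scaled : 3 ^ c * (3 ^ (3 * u) * (3 ^ k * val e) ^ 3) ≤ 3 ^ c * 3 ^ (3 * i)
    scaled = begin
      3 ^ c * (3 ^ (3 * u) * (3 ^ k * val e) ^ 3)  ≡⟨ l (3 ^ c) (3 ^ (3 * u)) ((3 ^ k * val e) ^ 3) ⟩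
      (3 ^ k * val e) ^ 3 * (3 ^ c * 3 ^ (3 * u))  ≡⟨ cong ((3 ^ k * val e) ^ 3 *_) (^-distribˡ-+-* 3 c (3 * u)) ⟨
      (3 ^ k * val e) ^ 3 * 3 ^ (c + 3 * u)        ≤⟨ T-ceiling t ⟩
      3 ^ (c + 3 * i)                              ≡⟨ ^-distribˡ-+-* 3 c (3 * i) ⟩
      3 ^ c * 3 ^ (3 * i)                          ∎

  -- The numerator is 3 over 3^(u+1): over 3ᵘ the budget for the numerator 1 would be zero ones.
  T-power : ∀ c u → T c (c + 3 * u) (1 /3^ u)
  T-power c u = subst (T c (c + 3 * u)) (/3^-cancel 1 1 u)
    (T-rep (plus one (plus one one)) (1 + u) (l c u))
    where
    l : ∀ c u → 3 + (c + 3 * u) ≡ c + 3 * (1 + u)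
    l = solve-∀

-- Cantor normal forms from ranks

module OrdinalNotation where
  open import Defs using (CNF; _<O_)
  open TameSets hiding (<⇒≱; ≤∧≢⇒<)
  open import Data.Rational as ℚ using (ℚ; 0ℚ)
  import Data.Rational.Properties as ℚ
  open import Data.Nat
  open import Data.Nat.Properties
  open import Data.List using (List; []; _∷_; _++_; _∷ʳ_; [_])
  open import Data.List.Properties using (++-assoc; ∷ʳ-injective)
  open import Data.List.Relation.Binary.Lex.Strict using (base; halt; this; next)
  open import Data.List.Relation.Unary.All using (All; []; _∷_)
  open import Data.List.Relation.Unary.All.Properties using (∷ʳ⁺)
  open import Data.List.Relation.Unary.Linked using (Linked; []; [-]; _∷_)
  open import Induction.WellFounded using (Acc; acc)
  open import Relation.Binary.Definitions using (tri<; tri≈; tri>)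
  open import Relation.Unary using (_⊆_)

  private variable
    es fs ls : List ℕ
    r s m : ℕ
    x y : ℚ

  <O-snoc : ∀ es → es <O (es ∷ʳ r)
  <O-snoc [] = halt
  <O-snoc (e ∷ es) = next refl (<O-snoc es)

  <O-++ : es <O fs → es <O (fs ++ ls)
  <O-++ halt = halt
  <O-++ (this e<f) = this e<f
  <O-++ (next e≡f h) = next e≡f (<O-++ h)

  <O-diverge : ∀ es → m < r → (es ++ m ∷ ls) <O (es ∷ʳ r)
  <O-diverge [] m<r = this m<r
  <O-diverge (e ∷ es) m<r = next refl (<O-diverge es m<r)

  -- Appending 0 adds ω⁰ = 1 to the ordinal, and successors compare as their predecessors do. This
  -- passes from counting up to and including a point of rank 0 to its position.
  <O-unsnoc : ∀ es fs → (es ∷ʳ 0) <O (fs ∷ʳ 0) → es <O fs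
  <O-unsnoc [] [] (this ())
  <O-unsnoc [] [] (next _ h) = h
  <O-unsnoc [] (f ∷ fs) h = halt
  <O-unsnoc (e ∷ []) [] (next _ ())
  <O-unsnoc (e ∷ e′ ∷ es) [] (next _ ())
  <O-unsnoc (e ∷ es) (f ∷ fs) (this e<f) = this e<f
  <O-unsnoc (e ∷ es) (f ∷ fs) (next e≡f h) = next e≡f (<O-unsnoc es fs h)

  <O-irrefl : ¬ (es <O es)
  <O-irrefl (this e<e) = n≮n _ e<e
  <O-irrefl (next _ h) = <O-irrefl h

  <O-asym : es <O fs → ¬ (fs <O es)
  <O-asym halt ()
  <O-asym (this e<f) (this f<e) = <-asym e<f f<e
  <O-asym (this e<e) (next refl _) = n≮n _ e<e
  <O-asym (next refl _) (this e<e) = n≮n _ e<e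
  <O-asym (next _ h) (next _ h′) = <O-asym h h′

  CNF-snoc : ∀ es → CNF (es ∷ʳ s) → r ≤ s → CNF (es ∷ʳ s ∷ʳ r)
  CNF-snoc [] _ r≤s = r≤s ∷ [-]
  CNF-snoc (_ ∷ []) (h ∷ _) r≤s = h ∷ r≤s ∷ [-]
  CNF-snoc (_ ∷ e ∷ es) (h ∷ t) r≤s = h ∷ CNF-snoc (e ∷ es) t r≤s

  CNF-snoc-0 : CNF es → CNF (es ∷ʳ 0)
  CNF-snoc-0 [] = [-]
  CNF-snoc-0 [-] = z≤n ∷ [-]
  CNF-snoc-0 (h ∷ t) = h ∷ CNF-snoc-0 t

  CNF-init : ∀ es → CNF (es ∷ʳ r) → CNF es
  CNF-init [] _ = []
  CNF-init (_ ∷ []) _ = [-]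
  CNF-init (_ ∷ e ∷ es) (h ∷ t) = h ∷ CNF-init (e ∷ es) t

  -- The derived sets R 0 ⊇ R 1 ⊇ … of a set of positive rationals that is well-ordered by > and closed in it.
  record Hierarchy (R : ℕ → ℚSet) : Set where
    field
      positive : R r x → 0ℚ ℚ.< x
      weaken   : R (suc r) ⊆ R r
      member   : ∀ r → 0ℚ ℚ.< x → Dec (R r x)
      below    : ∀ r → 0ℚ ℚ.< x → GreatestBelow (R r) x
      above    : ∀ r → 0ℚ ℚ.< x → Inf (R (suc r)) (R r) x
      limits   : R (suc r) x → x ℚ.< y → ∃[ z ] (R r z × x ℚ.< z × z ℚ.< y)
      top      : ∀ r → ∃[ p ] (R r p × NoneAbove (R r) p)
      finite   : 0ℚ ℚ.< x → ∃[ r ] ¬ R r x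
      wf       : 0ℚ ℚ.< x → Acc (Above (R 0)) x

  module Ordinals {R : ℕ → ℚSet} (hierarchy : Hierarchy R) where
    open Hierarchy hierarchy

    antitone : r ≤ s → R s ⊆ R r
    antitone r≤s = go (≤⇒≤′ r≤s)
      where
      go : r ≤′ s → R s ⊆ R r
      go ≤′-refl Rx = Rx
      go (≤′-step h) Rx = go h (weaken Rx)

    Rank : ℚ → ℕ → Set
    Rank x r = R r x × ¬ R (suc r) x

    rank-≤ : Rank x s → R r x → r ≤ s
    rank-≤ (_ , ¬R) Rx = ≮⇒≥ λ s<r → ¬R (antitone s<r Rx)

    rank-unique : Rank x r → Rank x s → r ≡ s
    rank-unique ρ σ = ≤-antisym (rank-≤ σ (proj₁ ρ)) (rank-≤ ρ (proj₁ σ))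

    rank : R 0 x → ∃[ r ] Rank x r
    rank {x} R₀x = search (proj₁ (finite x>0)) (proj₂ (finite x>0))
      where
      x>0 = positive R₀x
      search : ∀ r → ¬ R r x → ∃[ r ] Rank x r
      search zero ¬R = ⊥-elim (¬R R₀x)
      search (suc r) ¬R with member r x>0
      ... | yes Rx = r , Rx , ¬R
      ... | no ¬Rx = search r ¬Rx

    Next : ℕ → ℚ → ℚ → Set
    Next r x y = R r y × x ℚ.< y × (∀ {z} → R r z → x ℚ.< z → y ℚ.≤ z)

    -- Notation x es r: in the order >, the points of rank 0 up to and including x have order type ω^es + ω^r, where r is
    -- the rank of x. The exponents are the ranks met on climbing from x, each time to the next point of no smaller rank.
    data Notation : ℚ → List ℕ → ℕ → Set where
      first : Rank x r → NoneAbove (R r) x → Notation x [] r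
      after : Rank x r → Next r x y → Notation y es s → Notation x (es ∷ʳ s) r

    notation-rank : Notation x es r → Rank x r
    notation-rank (first ρ _) = ρ
    notation-rank (after ρ _ _) = ρ

    notation : R 0 x → ∃[ es ] ∃[ r ] Notation x es r
    notation R₀x = climb R₀x (wf (positive R₀x))
      where
      climb : R 0 x → Acc (Above (R 0)) x → ∃[ es ] ∃[ r ] Notation x es r
      climb R₀x (acc rs) with rank R₀x
      ... | r , ρ with above r (positive R₀x)
      ...   | limit Rx = ⊥-elim (proj₂ ρ Rx)
      ...   | empty none = _ , _ , first ρ none
      ...   | attains (least y Ry x<y min) with climb (antitone z≤n Ry) (rs (antitone z≤n Ry , x<y))
      ...     | _ , _ , N = _ , _ , after ρ (Ry , x<y , min) N

    notation-unique : Notation x es r → Notation x fs s → es ∷ʳ r ≡ fs ∷ʳ s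
    notation-unique (first ρ _) (first σ _) = cong [_] (rank-unique ρ σ)
    notation-unique (first ρ none) (after σ (Ry , x<y , _) _) with rank-unique ρ σ
    ... | refl = ⊥-elim (TameSets.<⇒≱ x<y (none Ry))
    notation-unique (after σ (Ry , x<y , _) _) (first ρ none) with rank-unique ρ σ
    ... | refl = ⊥-elim (TameSets.<⇒≱ x<y (none Ry))
    notation-unique (after ρ (Ry , x<y , ymin) N) (after σ (Rz , x<z , zmin) M) with rank-unique ρ σ
    ... | refl with ℚ.≤-antisym (ymin Rz x<z) (zmin Ry x<y)
    ...   | refl = cong (_∷ʳ _) (notation-unique N M)

    private
      -- Among normal forms, these are ordinals strictly between ω^es and ω^es + ω^r.
      Extends : List ℕ → ℕ → List ℕ → Set
      Extends es r fs = ∃[ m ] ∃[ ls ] (m < r × fs ≡ es ++ m ∷ ls)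

      extend : Extends es r fs → Extends es r (fs ∷ʳ s)
      extend {es} (m , ls , m<r , refl) = m , ls ∷ʳ _ , m<r , ++-assoc es (m ∷ ls) _

      beyond : NoneAbove (R r) x → Notation y es s → x ℚ.< y → Extends [] r (es ∷ʳ s)
      beyond none (first ρ _) x<y = _ , [] , ≰⇒> (λ r≤s → TameSets.<⇒≱ x<y (none (antitone r≤s (proj₁ ρ)))) , refl
      beyond none (after ρ (_ , y<z , _) N) x<y = extend {[]} (beyond none N (ℚ.<-trans x<y y<z))

      -- All points strictly between x and y have rank below r, while y lies in every derived set up
      -- to r. A climb from z therefore cannot jump over y; it passes through y, and the exponents
      -- of y come first.
      between : Next r x y → Notation y es s → ∀ {z} → Notation z fs m → x ℚ.< z → z ℚ.< y →
                Extends (es ∷ʳ s) r (fs ∷ʳ m)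
      between {r} {x} {y} {es} {s} (Ry , x<y , min) N = go
        where
        smaller : ∀ {z m} → Rank z m → x ℚ.< z → z ℚ.< y → m < r
        smaller ρ x<z z<y = ≰⇒> λ r≤m → TameSets.<⇒≱ z<y (min (antitone r≤m (proj₁ ρ)) x<z)
        go : ∀ {z fs m} → Notation z fs m → x ℚ.< z → z ℚ.< y → Extends (es ∷ʳ s) r (fs ∷ʳ m)
        go (first ρ none) x<z z<y = ⊥-elim (TameSets.<⇒≱ z<y (none (antitone (<⇒≤ (smaller ρ x<z z<y)) Ry)))
        go (after {y = w} ρ (Rw , z<w , wmin) M) x<z z<y with ℚ.<-cmp w y
        ... | tri< w<y _ _ = extend (go M (ℚ.<-trans x<z z<w) w<y)
        ... | tri≈ _ refl _ = _ , [] , smaller ρ x<z z<y , cong (_∷ʳ _) (notation-unique M N)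
        ... | tri> _ _ y<w = ⊥-elim (TameSets.<⇒≱ y<w (wmin (antitone (<⇒≤ (smaller ρ x<z z<y)) Ry) z<y))

      extends-< : Extends es r fs → fs <O (es ∷ʳ r)
      extends-< {es} (_ , _ , m<r , refl) = <O-diverge es m<r

    notation-mono : Notation x es r → Notation y fs s → x ℚ.< y → (fs ∷ʳ s) <O (es ∷ʳ r)
    notation-mono (first ρ none) M x<y = extends-< {[]} (beyond none M x<y)
    notation-mono {y = y} (after {y = z} {es} {s} ρ nxt N) M x<y with ℚ.<-cmp y z
    ... | tri< y<z _ _ = extends-< (between nxt N M x<y y<z)
    ... | tri≈ _ refl _ = subst (_<O (es ∷ʳ s ∷ʳ _)) (notation-unique N M) (<O-snoc (es ∷ʳ s))
    ... | tri> _ _ z<y = <O-++ (notation-mono N M z<y)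

    notation-CNF : Notation x es r → CNF (es ∷ʳ r)
    notation-CNF (first _ _) = [-]
    notation-CNF (after {es = es} _ (Ry , _) N) = CNF-snoc es (notation-CNF N) (rank-≤ (notation-rank N) Ry)

    -- A point of R (suc r) has points of R r above it, so the greatest point of R r has rank
    -- exactly r; its ordinal is ω^r.
    top-notation : ∀ {p} → R r p → NoneAbove (R r) p → Notation p [] r
    top-notation {p = p} Rp none = first (Rp , λ R′p →
      let z , Rz , p<z , _ = limits R′p (q<q+1 p) in TameSets.<⇒≱ p<z (none Rz)) none

    private
      -- The list is realised from left to right. The greatest x of R r below y has rank exactly r,
      -- because a point of R (suc r) would have points of R r between itself and y; the same
      -- maximality makes y the next point of R r after x.
      descend : Notation y es s → ∀ ls → CNF (s ∷ ls) → ∃[ x ] ∃[ fs ] ∃[ r ] (Notation x fs r × fs ∷ʳ r ≡ es ∷ʳ s ++ ls)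
      descend {y} {es} {s} N [] _ = y , es , s , N , sym (++-assoc es [ s ] [])
      descend {y} {es} {s} N (r ∷ ls) (r≤s ∷ h) with below r (positive (proj₁ (notation-rank N)))
      ... | greatest x Rx x<y max with descend (after (Rx , ¬R′x) (antitone r≤s (proj₁ (notation-rank N)) , x<y , min) N) ls h
        where
        ¬R′x : ¬ R (suc r) x
        ¬R′x R′x = let z , Rz , x<z , z<y = limits R′x x<y in TameSets.<⇒≱ x<z (max Rz z<y)
        min : ∀ {z} → R r z → x ℚ.< z → y ℚ.≤ z
        min Rz x<z = ℚ.≮⇒≥ λ z<y → TameSets.<⇒≱ x<z (max Rz z<y)
      ...   | z , fs , m , M , eq = z , fs , m , M , trans eq (snoc-++ es s r ls)
        where
        snoc-++ : ∀ es s r ls → (es ∷ʳ s) ∷ʳ r ++ ls ≡ es ∷ʳ s ++ r ∷ ls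
        snoc-++ es s r ls = ++-assoc (es ∷ʳ s) [ r ] ls

    realise : CNF es → ∃[ x ] Notation x es 0
    realise {[]} _ with top 0
    ... | p , Rp , none = p , top-notation Rp none
    realise {e ∷ es} h with top e
    ... | p , Rp , none with descend (top-notation Rp none) (es ∷ʳ 0) (CNF-snoc-0 h)
    ...   | x , fs , r , N , eq with ∷ʳ-injective fs (e ∷ es) eq
    ...     | refl , refl = x , N

    notation₀ : Rank x 0 → ∃[ es ] Notation x es 0
    notation₀ ρ with notation (proj₁ ρ)
    ... | es , r , N with rank-unique ρ (notation-rank N)
    ...   | refl = es , N

    module _ (N : Notation x es 0) (M : Notation y fs 0) where
      notation₀-mono : x ℚ.< y → fs <O es
      notation₀-mono x<y = <O-unsnoc fs es (notation-mono N M x<y)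

    notation₀-unique : Notation x es 0 → Notation x fs 0 → es ≡ fs
    notation₀-unique {es = es} {fs} N M = proj₁ (∷ʳ-injective es fs (notation-unique N M))

    notation₀-injective : Notation x es 0 → Notation y es 0 → x ≡ y
    notation₀-injective {x} {y = y} N M with ℚ.<-cmp x y
    ... | tri< x<y _ _ = ⊥-elim (<O-irrefl (notation₀-mono N M x<y))
    ... | tri≈ _ x≡y _ = x≡y
    ... | tri> _ _ y<x = ⊥-elim (<O-irrefl (notation₀-mono M N y<x))

    notation₀-cancel : Notation x es 0 → Notation y fs 0 → fs <O es → x ℚ.< y
    notation₀-cancel {x} {es} {y} {fs} N M fs<es with ℚ.<-cmp x y
    ... | tri< x<y _ _ = x<y
    ... | tri≈ _ refl _ = ⊥-elim (<O-irrefl (subst (_<O es) (notation₀-unique M N) fs<es))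
    ... | tri> _ _ y<x = ⊥-elim (<O-asym fs<es (notation₀-mono M N y<x))

    module _ {k p} (Rp : R k p) (none : NoneAbove (R k) p) where

      -- The exponents are ranks of points above x, hence above p, where R k has none.
      exponents-< : Notation x es r → p ℚ.≤ x → All (_< k) es
      exponents-< (first _ _) _ = []
      exponents-< (after ρ (_ , x<y , _) N) p≤x = ∷ʳ⁺ (exponents-< N (ℚ.<⇒≤ p<y))
        (≰⇒> λ k≤s → TameSets.<⇒≱ p<y (none (antitone k≤s (proj₁ (notation-rank N)))))
        where p<y = ℚ.≤-<-trans p≤x x<y

      -- p has the code [ k ], so x < p would put [ k ] below es ∷ʳ 0, which exponents below k
      -- exclude.
      exponents-<⁻¹ : Notation x es 0 → All (_< k) es → p ℚ.≤ x
      exponents-<⁻¹ N es<k = ℚ.≮⇒≥ λ x<p → absurd es<k (notation-mono N (top-notation Rp none) x<p)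
        where
        absurd : All (_< k) es → ¬ ([ k ] <O (es ∷ʳ 0))
        absurd [] (next _ (base ()))
        absurd (e<k ∷ _) (this k<e) = <-asym k<e e<k
        absurd (k<k ∷ _) (next refl _) = n≮n _ k<k

-- Stable defects as points of rank 0

module StableDefects where
  open import Defs
  open TameSets using (Above)
  open Complexity
  open TernaryFractions
  open Closure
  open ClosureOrder
  open OrdinalNotation
  open import Data.Rational as ℚ using (ℚ)
  import Data.Rational.Properties as ℚ
  open import Data.Nat
  open import Data.Nat.Properties
  open import Data.Nat.Divisibility using (_∣_; divides; m∣m*n; ∣-trans)
  open import Data.Nat.DivMod using (m≡m%n+[m/n]*n; m%n<n; [m+kn]%n≡m%n; m<n⇒m%n≡m)
  open import Data.Nat.Induction using (<-wellFounded)
  open import Data.Nat.Primality using (prime?; euclidsLemma)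
  open import Data.Nat.Tactic.RingSolver using (solve-∀)
  open import Data.List using (List)
  open import Function.Bundles using (_⇔_; mk⇔)
  open import Induction.WellFounded using (Acc; acc)
  open import Relation.Nullary.Decidable using (from-yes)

  T-hierarchy : ∀ a → Hierarchy (T a)
  T-hierarchy a = record
    { positive = T-pos ; weaken = T-weaken ; member = λ _ → T-member ; below = λ _ → T-below ; above = λ _ → T-above
    ; limits = T-limit ; top = λ _ → T-top ; finite = T-finite ; wf = T-wf }

  private
    3∣cube : ∀ n → 3 ∣ n ^ 3 → 3 ∣ n
    3∣cube n h with euclidsLemma n (n * (n * 1)) (from-yes (prime? 3)) h
    ... | inj₁ d = d
    ... | inj₂ h′ with euclidsLemma n (n * 1) (from-yes (prime? 3)) h′
    ...   | inj₁ d = d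
    ...   | inj₂ d = subst (3 ∣_) (*-identityʳ n) d

    cube>0 : ∀ {n} → 0 < n → 0 < n ^ 3
    cube>0 {suc n} _ = m^n>0 (suc n) 3

    -- 3-adic descent.
    no-cube-ratio : ∀ n m → Acc _<_ n → 0 < n → ∀ r → 0 < r → r < 3 → n ^ 3 ≢ 3 ^ r * m ^ 3
    no-cube-ratio n zero _ n>0 r _ _ eq = <⇒≱ (cube>0 n>0) (≤-reflexive (trans eq (*-zeroʳ (3 ^ r))))
    no-cube-ratio n m@(suc _) (acc rs) n>0 (suc r) _ r<3 eq
      with 3∣cube n (subst (3 ∣_) (sym eq) (∣-trans (m∣m*n (3 ^ r)) (m∣m*n (m ^ 3))))
    ... | divides p refl = no-cube-ratio m p (rs m<n) (s≤s z≤n) (2 ∸ r) (m<n⇒0<n∸m (≤-pred r<3)) (s≤s (m∸n≤m 2 r))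
            (*-cancelˡ-≡ (m ^ 3) (3 ^ (2 ∸ r) * p ^ 3) (3 ^ suc r) {{m^n≢0 3 (suc r)}} (begin
              3 ^ suc r * m ^ 3                        ≡⟨ eq ⟨
              (p * 3) ^ 3                              ≡⟨ trans (cube-* p 3) (*-comm (p ^ 3) (3 ^ 3)) ⟩
              3 ^ 3 * p ^ 3                            ≡⟨ cong (λ x → 3 ^ x * p ^ 3) (m+[n∸m]≡n (<⇒≤ r<3)) ⟨
              3 ^ (suc r + (2 ∸ r)) * p ^ 3            ≡⟨ cong (_* p ^ 3) (^-distribˡ-+-* 3 (suc r) (2 ∸ r)) ⟩
              3 ^ suc r * 3 ^ (2 ∸ r) * p ^ 3          ≡⟨ *-assoc (3 ^ suc r) (3 ^ (2 ∸ r)) (p ^ 3) ⟩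
              3 ^ suc r * (3 ^ (2 ∸ r) * p ^ 3)        ∎))
      where
      open ≡-Reasoning
      m<n : m < p * 3
      m<n = cube-cancel-< (<-≤-trans (m<m*n (m ^ 3) (3 ^ suc r) {{m^n≢0 m 3}} (^-monoʳ-< 3 (s≤s (s≤s z≤n)) {0} {suc r} (s≤s z≤n)))
              (≤-reflexive (trans (*-comm (m ^ 3) (3 ^ suc r)) (sym eq))))

  cube-injective : ∀ {x y} → x ^ 3 ≡ y ^ 3 → x ≡ y
  cube-injective eq = ≤-antisym (cube-cancel-≤ (≤-reflexive eq)) (cube-cancel-≤ (≤-reflexive (sym eq)))

  private
    cube-ratio-≤ : ∀ {n m} z → 0 < n → n ^ 3 ≡ 3 ^ z * m ^ 3 → ∃[ v ] (n ≡ 3 ^ v * m × z ≡ 3 * v)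
    cube-ratio-≤ {n} {m} z n>0 eq = v , cube-injective n³≡ , z≡
      where
      open ≡-Reasoning
      v = z / 3
      split : n ^ 3 ≡ 3 ^ (z % 3) * (3 ^ v * m) ^ 3
      split = begin
        n ^ 3                                      ≡⟨ eq ⟩
        3 ^ z * m ^ 3                              ≡⟨ cong (λ x → 3 ^ x * m ^ 3) (trans (m≡m%n+[m/n]*n z 3) (cong (z % 3 +_) (*-comm v 3))) ⟩
        3 ^ (z % 3 + 3 * v) * m ^ 3                ≡⟨ cong (_* m ^ 3) (^-distribˡ-+-* 3 (z % 3) (3 * v)) ⟩
        3 ^ (z % 3) * 3 ^ (3 * v) * m ^ 3          ≡⟨ *-assoc (3 ^ (z % 3)) (3 ^ (3 * v)) (m ^ 3) ⟩
        3 ^ (z % 3) * (3 ^ (3 * v) * m ^ 3)        ≡⟨ cong (3 ^ (z % 3) *_) (pow-scaled v m) ⟨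
        3 ^ (z % 3) * (3 ^ v * m) ^ 3              ∎
      z%3≡0 : z % 3 ≡ 0
      z%3≡0 = n≤0⇒n≡0 (≮⇒≥ λ r>0 → no-cube-ratio n (3 ^ v * m) (<-wellFounded n) n>0 (z % 3) r>0 (m%n<n z 3) split)
      n³≡ : n ^ 3 ≡ (3 ^ v * m) ^ 3
      n³≡ = trans split (trans (cong (λ r → 3 ^ r * (3 ^ v * m) ^ 3) z%3≡0) (*-identityˡ ((3 ^ v * m) ^ 3)))
      z≡ : z ≡ 3 * v
      z≡ = trans (m≡m%n+[m/n]*n z 3) (trans (cong (_+ v * 3) z%3≡0) (*-comm v 3))

    pow-cancel : ∀ x z n m → 3 ^ x * n ^ 3 ≡ 3 ^ (x + z) * m ^ 3 → n ^ 3 ≡ 3 ^ z * m ^ 3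
    pow-cancel x z n m eq = *-cancelˡ-≡ (n ^ 3) (3 ^ z * m ^ 3) (3 ^ x) {{m^n≢0 3 x}}
      (trans eq (trans (cong (_* m ^ 3) (^-distribˡ-+-* 3 x z)) (*-assoc (3 ^ x) (3 ^ z) (m ^ 3))))

  -- Equal defects make (n/m)³ a power of 3. As 3 and 9 have no rational cube root, its exponent is
  -- a multiple of 3, so n/m is itself a power of 3 and the complexities x and y differ accordingly.
  cube-ratio : ∀ {n m} x y → 0 < n → 0 < m → 3 ^ x * n ^ 3 ≡ 3 ^ y * m ^ 3 →
               ∃[ u ] ∃[ v ] (3 ^ u * n ≡ 3 ^ v * m × x + 3 * v ≡ y + 3 * u)
  cube-ratio {n} {m} x y n>0 m>0 eq with ≤-total x y
  ... | inj₁ x≤y with m≤n⇒∃[o]m+o≡n x≤y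
  ...   | z , refl with cube-ratio-≤ {n} {m} z n>0 (pow-cancel x z n m eq)
  ...     | v , n≡ , refl = 0 , v , trans (*-identityˡ n) n≡ , sym (+-identityʳ (x + 3 * v))
  cube-ratio {n} {m} x y n>0 m>0 eq | inj₂ y≤x with m≤n⇒∃[o]m+o≡n y≤x
  ...   | z , refl with cube-ratio-≤ {m} {n} z m>0 (pow-cancel y z m n (sym eq))
  ...     | u , m≡ , refl = u , 0 , trans (sym m≡) (sym (*-identityˡ m)) , +-identityʳ (y + 3 * u)

  IsCpx-unique : ∀ {n c c′} → IsCpx n c → IsCpx n c′ → c ≡ c′
  IsCpx-unique ((e , ve , oe) , min) ((e′ , ve′ , oe′) , min′) =
    ≤-antisym (subst (_ ≤_) oe′ (min e′ ve′)) (subst (_ ≤_) oe (min′ e ve))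

  module Defects (a : ℕ) (a<3 : a < 3) where
    open Ordinals (T-hierarchy a)

    -- Defects in the class a are compared through the rational n / 3ⁱ, where ‖n‖ = a + 3i.
    pow-class : ∀ i m → 3 ^ (a + 3 * i) * m ^ 3 ≡ 3 ^ a * (3 ^ i * m) ^ 3
    pow-class i m = trans (cong (_* m ^ 3) (^-distribˡ-+-* 3 a (3 * i)))
      (trans (*-assoc (3 ^ a) (3 ^ (3 * i)) (m ^ 3)) (cong (3 ^ a *_) (sym (pow-scaled i m))))

    module _ {n m i j : ℕ} where
      defect-< : 3 ^ (a + 3 * i) * m ^ 3 < 3 ^ (a + 3 * j) * n ^ 3 → m /3^ j ℚ.< n /3^ i
      defect-< h = /3^-mono-< {m} {j} {n} {i} (cube-cancel-< (*-cancelˡ-< (3 ^ a) _ _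
        (subst₂ _<_ (pow-class i m) (pow-class j n) h)))

      defect-<⁻¹ : m /3^ j ℚ.< n /3^ i → 3 ^ (a + 3 * i) * m ^ 3 < 3 ^ (a + 3 * j) * n ^ 3
      defect-<⁻¹ h = subst₂ _<_ (sym (pow-class i m)) (sym (pow-class j n))
        (*-monoʳ-< (3 ^ a) {{m^n≢0 3 a}} (^-monoˡ-< 3 (/3^-cancel-< {m} {j} {n} {i} h)))

      defect-≤ : 3 ^ (a + 3 * i) * m ^ 3 ≤ 3 ^ (a + 3 * j) * n ^ 3 → m /3^ j ℚ.≤ n /3^ i
      defect-≤ h = /3^-mono-≤ {m} {j} {n} {i} (cube-cancel-≤ (*-cancelˡ-≤ (3 ^ a) {{m^n≢0 3 a}}
        (subst₂ _≤_ (pow-class i m) (pow-class j n) h)))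

      defect-≤⁻¹ : m /3^ j ℚ.≤ n /3^ i → 3 ^ (a + 3 * i) * m ^ 3 ≤ 3 ^ (a + 3 * j) * n ^ 3
      defect-≤⁻¹ h = subst₂ _≤_ (sym (pow-class i m)) (sym (pow-class j n))
        (*-monoʳ-≤ (3 ^ a) (^-monoˡ-≤ 3 (/3^-cancel-≤ {m} {j} {n} {i} h)))

    module _ {n i : ℕ} (cpx : IsCpx n (a + 3 * i)) where

      cpx⇒T : T a 0 (n /3^ i)
      cpx⇒T with proj₁ cpx
      ... | e , refl , oe = T-rep e i (trans (+-identityʳ (ones e)) oe)

      -- A representation of n / 3ⁱ with a unit of budget left would, after scaling by powers of 3,
      -- write a 3-power multiple of m with one 1 fewer than stability prescribes.
      stable⇒¬T : ∀ {m} → 0 < n → Stable m → m δ≈ n → ¬ T a 1 (n /3^ i)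
      stable⇒¬T {m} n>0 (m>0 , stable) (cm , cn , cpx-m , cpx-n , eq) t with T-integral t
      ... | f , j , bf , vf with IsCpx-unique cpx-n cpx
      ...   | refl with cube-ratio cm (a + 3 * i) n>0 m>0 eq
      -- The `suc` on both exponents guarantees the k ≥ 1 in `Stable`.
      ...     | u , v , n≡m , cm≡ = <⇒≱ (n<1+n _) (subst (_≤ ones (scale (suc (u + i)) f)) total
                  (proj₂ (stable (suc (v + j)) cm (s≤s z≤n) cpx-m) (scale (suc (u + i)) f) value))
        where
        cross : 3 ^ j * n ≡ 3 ^ i * val f
        cross = ≤-antisym (/3^-cancel-≤ {n} {i} {val f} {j} (ℚ.≤-reflexive vf))
                          (/3^-cancel-≤ {val f} {j} {n} {i} (ℚ.≤-reflexive (sym vf)))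
        open ≡-Reasoning
        value : val (scale (suc (u + i)) f) ≡ 3 ^ suc (v + j) * m
        value = begin
          val (scale (suc (u + i)) f)        ≡⟨ val-scale (suc (u + i)) f ⟩
          3 * 3 ^ (u + i) * val f            ≡⟨ cong (λ x → 3 * x * val f) (^-distribˡ-+-* 3 u i) ⟩
          3 * (3 ^ u * 3 ^ i) * val f        ≡⟨ l (3 ^ u) (3 ^ i) (val f) ⟩
          3 * 3 ^ u * (3 ^ i * val f)        ≡⟨ cong (3 * 3 ^ u *_) cross ⟨
          3 * 3 ^ u * (3 ^ j * n)            ≡⟨ r (3 ^ u) (3 ^ j) n ⟩
          3 * 3 ^ j * (3 ^ u * n)            ≡⟨ cong (3 * 3 ^ j *_) n≡m ⟩
          3 * 3 ^ j * (3 ^ v * m)            ≡⟨ s (3 ^ j) (3 ^ v) m ⟩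
          3 * (3 ^ v * 3 ^ j) * m            ≡⟨ cong (λ x → 3 * x * m) (^-distribˡ-+-* 3 v j) ⟨
          3 ^ suc (v + j) * m                ∎
          where
          l : ∀ x y z → 3 * (x * y) * z ≡ 3 * x * (y * z)
          l = solve-∀
          r : ∀ x y z → 3 * x * (y * z) ≡ 3 * y * (x * z)
          r = solve-∀
          s : ∀ x y z → 3 * x * (y * z) ≡ 3 * (y * x) * z
          s = solve-∀
        total : 3 * suc (v + j) + cm ≡ suc (ones (scale (suc (u + i)) f))
        total = begin
          3 * suc (v + j) + cm                       ≡⟨ l v j cm ⟩
          cm + 3 * v + 3 * suc j                     ≡⟨ cong (_+ 3 * suc j) cm≡ ⟩
          a + 3 * i + 3 * u + 3 * suc j              ≡⟨ r a i u j ⟩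
          a + 3 * j + 3 * suc (u + i)                ≡⟨ cong (_+ 3 * suc (u + i)) bf ⟨
          ones f + 1 + 3 * suc (u + i)               ≡⟨ s (ones f) (3 * suc (u + i)) ⟩
          suc (ones f + 3 * suc (u + i))             ≡⟨ cong suc (ones-scale (suc (u + i)) f) ⟨
          suc (ones (scale (suc (u + i)) f))         ∎
          where
          l : ∀ v j cm → 3 * suc (v + j) + cm ≡ cm + 3 * v + 3 * suc j
          l = solve-∀
          r : ∀ a i u j → a + 3 * i + 3 * u + 3 * suc j ≡ a + 3 * j + 3 * suc (u + i)
          r = solve-∀
          s : ∀ x y → x + 1 + y ≡ suc (x + y)
          s = solve-∀

    module _ (e : Expr) (i : ℕ) (budget : ones e ≡ a + 3 * i) (¬T₁ : ¬ T a 1 (val e /3^ i)) where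

      -- An expression for 3ᵏ * val e that saves o + 1 ones represents the same rational with o + 1
      -- units of budget left, placing it in T a (suc o) and so in T a 1.
      scaled-cpx : ∀ k → IsCpx (3 ^ k * val e) (3 * k + (a + 3 * i))
      scaled-cpx k = (scale k e , val-scale k e , trans (ones-scale k e) (trans (+-comm (ones e) (3 * k)) (cong (3 * k +_) budget))) ,
        λ f vf → ≮⇒≥ λ cheaper → refute f vf (m≤n⇒∃[o]m+o≡n cheaper)
        where
        open ≡-Reasoning
        l : ∀ a k i → 3 * k + (a + 3 * i) ≡ a + 3 * (k + i)
        l = solve-∀
        refute : ∀ f → val f ≡ 3 ^ k * val e → ¬ (∃[ o ] suc (ones f) + o ≡ 3 * k + (a + 3 * i))
        refute f vf (o , eq) = ¬T₁ (T-strict {suc o} {a} {0} (s≤s z≤n)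
          (subst (T a (suc o)) (trans (cong (_/3^ (k + i)) vf) (/3^-cancel k (val e) i))
            (T-rep f (k + i) (trans (+-suc (ones f) o) (trans eq (l a k i))))))

      cpx : IsCpx (val e) (a + 3 * i)
      cpx = subst (λ n → IsCpx n (a + 3 * i)) (*-identityˡ (val e)) (scaled-cpx 0)

      stable : Stable (val e)
      stable = val>0 e , λ k c _ cpx′ → subst (λ c → IsCpx (3 ^ k * val e) (3 * k + c)) (IsCpx-unique cpx cpx′) (scaled-cpx k)

      -- The number 1 is unstable: `three` writes 3 with three ones, against the four or more
      -- prescribed by `scaled-cpx`.
      not-one : val e ≢ 1
      not-one eq = <⇒≱ (n<1+n 3) (≤-trans (s≤s (s≤s (s≤s one≤))) three-cheap)
        where
        one≤ : 1 ≤ a + 3 * i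
        one≤ = subst (1 ≤_) budget (ones>0 e)
        three-cheap : 3 + (a + 3 * i) ≤ 3
        three-cheap = proj₂ (scaled-cpx 1) three (sym (cong (3 *_) eq))

      inDaSt : InDaSt a (val e)
      inDaSt = val>0 e , not-one ,
        (a + 3 * i , cpx , trans (cong (λ x → (a + x) % 3) (*-comm 3 i)) (trans ([m+kn]%n≡m%n a i 3) (m<n⇒m%n≡m a<3))) ,
        (val e , stable , a + 3 * i , a + 3 * i , cpx , cpx , refl)

    exponent : ∀ {n} → InDaSt a n → ℕ
    exponent (_ , _ , (c , _) , _) = c / 3

    exponent-cpx : ∀ {n} (h : InDaSt a n) → IsCpx n (a + 3 * exponent h)
    exponent-cpx {n} (_ , _ , (c , cpx , c%3≡a) , _) = subst (IsCpx n)
      (trans (m≡m%n+[m/n]*n c 3) (cong₂ _+_ c%3≡a (*-comm (c / 3) 3))) cpx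

    point : ∀ {n} → InDaSt a n → ℚ
    point {n} h = n /3^ exponent h

    opaque
      point-rank : ∀ {n} (h : InDaSt a n) → Rank (point h) 0
      point-rank h@(n>0 , _ , _ , (m , stable , eq)) =
        cpx⇒T (exponent-cpx h) , stable⇒¬T (exponent-cpx h) n>0 stable eq

      code : ∀ {n} → InDaSt a n → List ℕ
      code h = proj₁ (notation₀ (point-rank h))

      code-notation : ∀ {n} (h : InDaSt a n) → Notation (point h) (code h) 0
      code-notation h = proj₂ (notation₀ (point-rank h))

    module _ {n m : ℕ} (g : InDaSt a n) (h : InDaSt a m) where
      private
        i = exponent g
        j = exponent h

      δ<⇒point : n δ< m → point h ℚ.< point g
      δ<⇒point (cn , cm , cpx-n , cpx-m , lt) with IsCpx-unique cpx-n (exponent-cpx g) | IsCpx-unique cpx-m (exponent-cpx h)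
      ... | refl | refl = defect-< {n} {m} {i} {j} lt

      code-< : (n δ< m) ⇔ (code g <O code h)
      code-< = mk⇔ (λ lt → notation₀-mono (code-notation h) (code-notation g) (δ<⇒point lt))
        (λ lt → _ , _ , exponent-cpx g , exponent-cpx h ,
          defect-<⁻¹ {n} {m} {i} {j} (notation₀-cancel (code-notation h) (code-notation g) lt))

      code-≡ : (n δ≈ m) ⇔ (code g ≡ code h)
      code-≡ = mk⇔ to from
        where
        to : n δ≈ m → code g ≡ code h
        to (cn , cm , cpx-n , cpx-m , eq) with IsCpx-unique cpx-n (exponent-cpx g) | IsCpx-unique cpx-m (exponent-cpx h)
        ... | refl | refl = notation₀-unique (code-notation g) (subst (λ x → Notation x (code h) 0)
                (ℚ.≤-antisym (defect-≤ {n} {m} {i} {j} (≤-reflexive eq)) (defect-≤ {m} {n} {j} {i} (≤-reflexive (sym eq))))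
                (code-notation h))
        from : code g ≡ code h → n δ≈ m
        from eq = _ , _ , exponent-cpx g , exponent-cpx h ,
          ≤-antisym (defect-≤⁻¹ {n} {m} {i} {j} (ℚ.≤-reflexive (sym same))) (defect-≤⁻¹ {m} {n} {j} {i} (ℚ.≤-reflexive same))
          where
          same : point g ≡ point h
          same = notation₀-injective (code-notation g) (subst (λ es → Notation (point h) es 0) (sym eq) (code-notation h))

    code-CNF : ∀ {n} (h : InDaSt a n) → CNF (code h)
    code-CNF h = CNF-init (code h) (notation-CNF (code-notation h))

    -- The numerator of an integral representation of the realised point is the required n: rank 0
    -- says that no budget can be saved, which makes n stable of complexity a + 3i.
    code-surjective : ∀ es → CNF es → ∃[ n ] Σ[ h ∈ InDaSt a n ] code h ≡ es
    code-surjective es cnf with realise cnf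
    ... | x , N with T-integral (proj₁ (notation-rank N))
    ...   | e , i , b , refl = val e , h , notation₀-unique (code-notation h)
              (subst (λ j → Notation (val e /3^ j) es 0) (sym exp≡) N)
      where
      b′ : ones e ≡ a + 3 * i
      b′ = trans (sym (+-identityʳ (ones e))) b
      h : InDaSt a (val e)
      h = inDaSt e i b′ (proj₂ (notation-rank N))
      exp≡ : exponent h ≡ i
      exp≡ = *-cancelˡ-≡ _ i 3 (+-cancelˡ-≡ a _ _ (IsCpx-unique (exponent-cpx h) (cpx e i b′ (proj₂ (notation-rank N)))))

    well-ordered : WellOrderedδ (InDaSt a)
    well-ordered (n , h) = go h (T-wf (T-pos (proj₁ (point-rank h))))
      where
      go : ∀ {n} (h : InDaSt a n) → Acc (Above (T a 0)) (point h) →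
           Acc (λ (x y : Σ ℕ (InDaSt a)) → proj₁ x δ< proj₁ y) (n , h)
      go h (acc rs) = acc λ { {m , g} lt → go g (rs (proj₁ (point-rank g) , δ<⇒point g h lt)) }

    order-type : OrderTypeIs (InDaSt a) CNF
    order-type = record
      { f = λ { (_ , h) → code h }
      ; f-in = λ { (_ , h) → code-CNF h }
      ; f-surj = λ es cnf → let n , h , eq = code-surjective es cnf in (n , h) , eq
      ; f-eq = λ { (_ , g) (_ , h) → code-≡ g h }
      ; f-lt = λ { (_ , g) (_ , h) → code-< g h } }

    module _ (u : ℕ) where
      private
        -- The bound k = a + 3u behaves like the defect of a number 1 of complexity k, so it
        -- corresponds to the point 1/3ᵘ.
        δ≤⇒point : ∀ {n} (h : InDaSt a n) → δ≤ n (a + 3 * u) → 1 /3^ u ℚ.≤ point h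
        δ≤⇒point {n} h (c , cpx , le) with IsCpx-unique cpx (exponent-cpx h)
        ... | refl = defect-≤ {n} {1} {exponent h} {u} (subst (_≤ 3 ^ (a + 3 * u) * n ^ 3) (sym (*-identityʳ _)) le)

        point⇒δ≤ : ∀ {n} (h : InDaSt a n) → 1 /3^ u ℚ.≤ point h → δ≤ n (a + 3 * u)
        point⇒δ≤ {n} h le = a + 3 * exponent h , exponent-cpx h ,
          subst (_≤ 3 ^ (a + 3 * u) * n ^ 3) (*-identityʳ _) (defect-≤⁻¹ {n} {1} {exponent h} {u} le)

      bounded-order-type : OrderTypeIs (λ n → InDaSt a n × δ≤ n (a + 3 * u)) (CNFbelow (a + 3 * u))
      bounded-order-type = record
        { f = λ { (_ , h , _) → code h }
        ; f-in = λ { (_ , h , le) → code-CNF h , exponents-< (T-power a u) (T-max u) (code-notation h) (δ≤⇒point h le) }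
        ; f-surj = surj
        ; f-eq = λ { (_ , g , _) (_ , h , _) → code-≡ g h }
        ; f-lt = λ { (_ , g , _) (_ , h , _) → code-< g h } }
        where
        surj : ∀ es → CNFbelow (a + 3 * u) es → Σ[ x ∈ Σ ℕ (λ n → InDaSt a n × δ≤ n (a + 3 * u)) ] code (proj₁ (proj₂ x)) ≡ es
        surj es (cnf , es<k) with code-surjective es cnf
        ... | n , h , refl = (n , h , point⇒δ≤ h (exponents-<⁻¹ (T-power a u) (T-max u) (code-notation h) es<k)) , refl

open import Defs
open import Data.Nat using (ℕ; _<_; _%_; _+_; _*_; _/_)
open import Data.Nat.DivMod using (m≡m%n+[m/n]*n)
open import Data.Nat.Properties using (*-comm)
open StableDefects using (module Defects)

theorem7p3 : (a : ℕ) → a < 3 →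
    WellOrderedδ (InDaSt a) × OrderTypeIs (InDaSt a) CNF
    × ((k : ℕ) → k % 3 ≡ a →
    OrderTypeIs (λ n → InDaSt a n × δ≤ n k) (CNFbelow k))
theorem7p3 a a<3 = well-ordered , order-type , λ k k%3≡a →
  subst (λ k → OrderTypeIs (λ n → InDaSt a n × δ≤ n k) (CNFbelow k))
    (sym (trans (m≡m%n+[m/n]*n k 3) (cong₂ _+_ k%3≡a (*-comm (k / 3) 3)))) (bounded-order-type (k / 3))
  where open Defects a a<3
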